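{- Let the sequence $(b_0,b_1,\ldots)$ be defined by $b_0:=0$ and $b_k:=E_{2k-2}$ for $k\ge1$, where $E_j$ are the Euler numbers. Then for all $n\ge1$, $$H_n(b_k)=\frac{(-1)^n}{4^n\,n!^2}\cdot\mathcal{K}_n\cdot H_n(E_{2k}),\qquad\text{where}\quad \mathcal{K}_n:=\sum_{j=0}^{n-1}\frac{16^j}{(2j+1)^2\binom{2j}{j}^2}.$$
   Context: For a sequence $(a_k)_{k\ge 0}$ and $n\ge 0$, $H_n(a_k):=\det(a_{i+j})_{0\le i,j\le n}$ denotes the $(n+1)\times(n+1)$ Hankel determinant; all sequences are indexed by $k\ge0$. The Euler numbers are defined by $\frac{2}{e^t+e^{ -t}}=\sum_{n\ge0}E_n\frac{t^n}{n!}$. The notation $n!^2$ means $(n!)^2$. -}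

module Defs where

open import Data.Fin.Base as Fin using (Fin; toℕ; punchIn)
open import Data.Integer.Base as ℤ using (ℤ; 1ℤ; -1ℤ)
open import Data.Nat.Base as ℕ using (ℕ; zero; suc; _!; z≤n; s≤s)
open import Data.Nat.Combinatorics using (_C_; nCk+nC[k+1]≡[n+1]C[k+1])
import Data.Nat.Properties as ℕ
open import Data.Rational.Base
open import Data.Rational.Properties
open import Relation.Binary.PropositionalEquality
open import Algebra.Properties.Monoid.Sum +-0-monoid using (sum-syntax; sum⁺-syntax; sum-cong-≗)

fromℕ : ℕ → ℚ
fromℕ n = ℤ.+ n / 1

-- A formal power series over ℚ, given by its ordinary coefficients.
Series : Set
Series = ℕ → ℚ

infixl 6 _⊕_
infixl 7 _⊛_ _⊘_

const : ℚ → Series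
const c zero    = c
const c (suc _) = 0ℚ

_⊕_ : Series → Series → Series
(f ⊕ g) n = f n + g n

_⊛_ : Series → Series → Series
(f ⊛ g) n = ∑[ i ≤ n ] (f (toℕ i) * g (n ℕ.∸ toℕ i))

-- Long division: with c = f₀ / g₀, one has f / g = c + t · (((f − c g) / t) / g).
-- That this is division is ⊘-⊛ below.
_⊘_ : (f g : Series) .{{_ : NonZero (g 0)}} → Series
(f ⊘ g) zero    = f 0 ÷ g 0
(f ⊘ g) (suc n) = ((λ k → f (suc k) - (f 0 ÷ g 0) * g (suc k)) ⊘ g) n

-- The series of e^{ct}.
exp : ℤ → Series
exp c n = ((c ℤ.^ n) / (n !)) {{n ℕ.!≢0}}

-- E n is n! times the coefficient of tⁿ in 2 / (eᵗ + e⁻ᵗ); see E-egf.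
E : ℕ → ℚ
E n = fromℕ (n !) * (const (fromℕ 2) ⊘ (exp 1ℤ ⊕ exp -1ℤ)) n

Matrix : ℕ → Set
Matrix n = Fin n → Fin n → ℚ

-- Laplace expansion along the first row.
det : ∀ n → Matrix n → ℚ
det zero    M = 1ℚ
det (suc n) M =
  ∑[ j < suc n ]
    ((-1ℤ ℤ.^ toℕ j) / 1 * M Fin.zero j
      * det n (λ i k → M (Fin.suc i) (punchIn j k)))

-- The Hankel determinant has size n + 1.
H : ℕ → (ℕ → ℚ) → ℚ
H n a = det (suc n) (λ i j → a (toℕ i ℕ.+ toℕ j))

b : ℕ → ℚ
b zero      = 0ℚ
b k@(suc _) = E (2 ℕ.* k ℕ.∸ 2)

nCk≢0 : ∀ {n k} → k ℕ.≤ n → ℕ.NonZero (n C k)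
nCk≢0 z≤n = _
nCk≢0 (s≤s {k} {n} k≤n) =
  subst ℕ.NonZero (nCk+nC[k+1]≡[n+1]C[k+1] n k)
    (ℕ.>-nonZero (ℕ.≤-trans (ℕ.>-nonZero⁻¹ (n C k) {{nCk≢0 k≤n}}) (ℕ.m≤m+n _ _)))

𝒦-denom≢0 : ∀ j → ℕ.NonZero ((2 ℕ.* j ℕ.+ 1) ℕ.^ 2 ℕ.* ((2 ℕ.* j) C j) ℕ.^ 2)
𝒦-denom≢0 j =
  ℕ.m*n≢0 _ _
    {{ℕ.m^n≢0 _ 2 {{ℕ.≢-nonZero (ℕ.m+1+n≢0 (2 ℕ.* j))}}}}
    {{ℕ.m^n≢0 _ 2 {{nCk≢0 (ℕ.m≤m+n j _)}}}}

𝒦 : ℕ → ℚ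
𝒦 n = ∑[ i < n ] term (toℕ i)
  where
  term : ℕ → ℚ
  term j = ((ℤ.+ (16 ℕ.^ j)) / ((2 ℕ.* j ℕ.+ 1) ℕ.^ 2 ℕ.* ((2 ℕ.* j) C j) ℕ.^ 2))
             {{𝒦-denom≢0 j}}

4ⁿn!²≢0 : ∀ n → ℕ.NonZero (4 ℕ.^ n ℕ.* (n !) ℕ.^ 2)
4ⁿn!²≢0 n = ℕ.m*n≢0 _ _ {{ℕ.m^n≢0 4 n}} {{ℕ.m^n≢0 (n !) 2 {{n ℕ.!≢0}}}}

------------------------------------------------------------------------
-- Correctness of _⊘_ and E

open ≡-Reasoning

÷-* : ∀ p q .{{_ : NonZero q}} → p ÷ q * q ≡ p
÷-* p q = begin
  p * 1/ q * q   ≡⟨ *-assoc p (1/ q) q ⟩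
  p * (1/ q * q) ≡⟨ cong (p *_) (*-inverseˡ q) ⟩
  p * 1ℚ         ≡⟨ *-identityʳ p ⟩
  p              ∎

⊘-⊛ : ∀ f g .{{_ : NonZero (g 0)}} → (f ⊘ g) ⊛ g ≗ f
⊘-⊛ f g zero    = trans (+-identityʳ _) (÷-* (f 0) (g 0))
⊘-⊛ f g (suc n) = begin
  x + ((f′ ⊘ g) ⊛ g) n ≡⟨ cong (x +_) (⊘-⊛ f′ g n) ⟩
  x + (y - x)          ≡⟨ cong (x +_) (+-comm y (- x)) ⟩
  x + (- x + y)        ≡⟨ +-assoc x (- x) y ⟨
  x - x + y            ≡⟨ cong (_+ y) (+-inverseʳ x) ⟩
  0ℚ + y               ≡⟨ +-identityˡ y ⟩
  y                    ∎
  where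
  f′ : Series
  f′ k = f (suc k) - (f 0 ÷ g 0) * g (suc k)
  x = (f 0 ÷ g 0) * g (suc n)
  y = f (suc n)

fromℕ-nonZero : ∀ n .{{_ : ℕ.NonZero n}} → NonZero (fromℕ n)
fromℕ-nonZero n = pos⇒nonZero (fromℕ n) {{normalize-pos n 1}}

egf : (ℕ → ℚ) → Series
egf a n = (a n ÷ fromℕ (n !)) {{fromℕ-nonZero (n !) {{n ℕ.!≢0}}}}

E-coeff : egf E ≗ const (fromℕ 2) ⊘ (exp 1ℤ ⊕ exp -1ℤ)
E-coeff n = begin
  N * q * 1/ N   ≡⟨ cong (_* 1/ N) (*-comm N q) ⟩
  q * N * 1/ N   ≡⟨ *-assoc q N (1/ N) ⟩
  q * (N * 1/ N) ≡⟨ cong (q *_) (*-inverseʳ N) ⟩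
  q * 1ℚ         ≡⟨ *-identityʳ q ⟩
  q              ∎
  where
  N = fromℕ (n !)
  q = (const (fromℕ 2) ⊘ (exp 1ℤ ⊕ exp -1ℤ)) n
  instance
    N≢0 : NonZero N
    N≢0 = fromℕ-nonZero (n !) {{n ℕ.!≢0}}

E-egf : egf E ⊛ (exp 1ℤ ⊕ exp -1ℤ) ≗ const (fromℕ 2)
E-egf n = trans
  (sum-cong-≗ {suc n} λ i → cong (_* (exp 1ℤ ⊕ exp -1ℤ) (n ℕ.∸ toℕ i)) (E-coeff (toℕ i)))
  (⊘-⊛ (const (fromℕ 2)) (exp 1ℤ ⊕ exp -1ℤ) n)

module Submission where

-- Let A n k = n! [tⁿ] sech t tanhᵏ t, so that E n = A n 0. Since (sech tanhᵏ)′ = k sech tanhᵏ⁻¹ − (k + 1) sech tanhᵏ⁺¹,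
-- passing from A n _ to A (n + 1) _ is symmetric for the form ∑ₖ (−1)ᵏ uₖ vₖ, which gives
--   E (2i + 2j)     =   ∑ₖ A (2i) (2k) A (2j) (2k),
--   E (2i + 2j + 2) = − ∑ₖ A (2i + 1) (2k + 1) A (2j + 1) (2k + 1),
-- two triangular factorizations with diagonals (2k)! and (2k + 1)!. Moreover E (2j) = ∑ₖ rₖ A (2j + 1) (2k + 1) with
-- rₖ = 4ᵏ k!² / (2k + 1)!. So the Hankel matrix of b is the matrix with first row (0, r₀, r₁, …), first column
-- likewise, and − I elsewhere, multiplied by a triangular matrix and its transpose; that matrix has determinant
-- (−1)ⁿ ∑ₖ rₖ², and rₖ² is the k-th term of 𝒦.

open import Data.Integer.Base using (1ℤ; -1ℤ)
open import Data.Nat.Base as ℕ using (ℕ; zero; suc; _!; z≤n; s≤s)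
open import Data.Rational.Base using (ℚ; _/_; _*_; _+_; -_; 0ℚ; 1ℚ)
open import Relation.Binary.PropositionalEquality
open import Defs
import Data.Integer.Base as ℤ
import Data.Integer.Properties as ℤ
import Data.Nat.Properties as ℕ
import Data.Rational.Base as ℚ
import Data.Rational.Properties as ℚ
import Data.Rational.Unnormalised.Base as ℚᵘ
import Data.Rational.Unnormalised.Properties as ℚᵘ
open import Algebra.Bundles using (CommutativeRing)
open import Algebra.Properties.Semiring.Sum (CommutativeRing.semiring ℚ.+-*-commutativeRing)
  using (sum; sum-syntax; sum-cong-≗; sum-replicate-zero; ∑-distrib-+; *-distribˡ-sum)
open import Data.Fin.Base using (Fin; zero; suc; toℕ; fromℕ<; inject₁; punchIn; punchOut)
open import Data.Fin.Properties
  using (_≟_; punchIn-injective; punchInᵢ≢i; punchIn-punchOut; toℕ-injective; toℕ-inject₁; toℕ<n; toℕ-fromℕ<; suc-injective)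
open import Data.Nat.Combinatorics using (_C_; nCk≡n!/k![n-k]!; k![n∸k]!∣n!)
open import Data.Nat.DivMod using (m/n*n≡m)
open import Data.Product.Base using (∃; _×_; _,_)
open import Data.Rational.Unnormalised.Base using (mkℚᵘ)
open import Data.Vec.Functional using (updateAt)
open import Data.Vec.Functional.Properties using (updateAt-updates; updateAt-minimal; updateAt-commutes)
open import Function.Base using (_∘_)
open import Level using (0ℓ)
open import Relation.Binary.Definitions using (tri<; tri≈; tri>)
open import Relation.Nullary using (yes; no; contradiction; dec⇒maybe)
open import Tactic.RingSolver using (solve-∀)
open import Tactic.RingSolver.Core.AlmostCommutativeRing using (AlmostCommutativeRing; fromCommutativeRing)
open ≡-Reasoning

-- `det` is a Laplace expansion, and its multiplicativity is never proved. Each Hankel matrix is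
-- written as a simpler matrix times an upper triangular one, and removing a triangular right factor
-- needs only that `det` is multilinear and alternating in the columns. The left triangular factor
-- is not split off; it stays inside the remaining matrix.
--
-- The rₖ are the coefficients in arcsin x / √(1 - x²) = ∑ₖ rₖ x²ᵏ⁺¹. At x = tanh t one has sech t =
-- √(1 - x²), and the integral of sech from 0 to t is arcsin x, hence equals ∑ₖ rₖ sech t tanh²ᵏ⁺¹
-- t. Its coefficient at t²ʲ⁺¹, times (2j + 1)!, is E (2j).
--
-- `E` comes from long division and `A` from a recurrence; they meet by uniqueness of quotients,
-- once the series built from `A n 0` times eᵗ + e⁻ᵗ is shown to be 2. The prefactor (-1)ⁿ / (4ⁿ
-- n!²) is the ratio of the diagonal products, by (2k + 2)! = 2 (k + 1) (2k + 1)!.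

ring : AlmostCommutativeRing 0ℓ 0ℓ
ring = fromCommutativeRing ℚ.+-*-commutativeRing (λ x → dec⇒maybe (0ℚ ℚ.≟ x))

-- Sums and products

sum-zero : ∀ {n} (t : Fin n → ℚ) → (∀ k → t k ≡ 0ℚ) → sum t ≡ 0ℚ
sum-zero {n} t t≡0 = trans (sum-cong-≗ t≡0) (sum-replicate-zero n)

sum-linear : ∀ {n} x (s t : Fin n → ℚ) → ∑[ k < n ] (x * s k + t k) ≡ x * sum s + sum t
sum-linear x s t =
  trans (∑-distrib-+ (λ k → x * s k) t) (cong (_+ sum t) (sym (*-distribˡ-sum x s)))

sum-adjacent : ∀ {n} (t : Fin (suc n) → ℚ) (j : Fin n) → t (inject₁ j) + t (suc j) ≡ 0ℚ →
  (∀ k → k ≢ inject₁ j → k ≢ suc j → t k ≡ 0ℚ) → sum t ≡ 0ℚ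
sum-adjacent t zero cancel rest = begin
  t zero + (t (suc zero) + sum r) ≡⟨ ℚ.+-assoc (t zero) _ _ ⟨
  t zero + t (suc zero) + sum r   ≡⟨ cong₂ _+_ cancel (sum-zero r λ k → rest (suc (suc k)) (λ ()) (λ ())) ⟩
  0ℚ + 0ℚ                         ∎
  where
  r = λ k → t (suc (suc k))
sum-adjacent t (suc j) cancel rest = cong₂ _+_
  (rest zero (λ ()) (λ ()))
  (sum-adjacent (t ∘ suc) j cancel
    (λ k k≢j k≢1+j → rest (suc k) (k≢j ∘ suc-injective) (k≢1+j ∘ suc-injective)))

sum-single : ∀ {n} (t : Fin n → ℚ) j → (∀ k → k ≢ j → t k ≡ 0ℚ) → sum t ≡ t j
sum-single t zero t≡0 = trans (cong (t zero +_) (sum-zero (t ∘ suc) λ k → t≡0 (suc k) λ ())) (ℚ.+-identityʳ _)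
sum-single t (suc j) t≡0 = trans
  (cong₂ _+_ (t≡0 zero λ ()) (sum-single (t ∘ suc) j λ k k≢j → t≡0 (suc k) (k≢j ∘ suc-injective)))
  (ℚ.+-identityˡ _)

sum-telescope : ∀ n (h : ℕ → ℚ) → ∑[ k < n ] (h (toℕ k) + - h (suc (toℕ k))) ≡ h 0 + - h n
sum-telescope zero    h = sym (ℚ.+-inverseʳ (h 0))
sum-telescope (suc n) h = trans (cong (h 0 + - h 1 +_) (sum-telescope n (λ k → h (suc k))))
  (collapse (h 0) (h 1) (h (suc n)))
  where
  collapse : ∀ x y z → x + - y + (y + - z) ≡ x + - z
  collapse = solve-∀ ring

sum-*-comm : ∀ {n} (s t : Fin n → ℚ) → ∑[ k < n ] (s k * t k) ≡ ∑[ k < n ] (t k * s k)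
sum-*-comm {n} s t = sum-cong-≗ {n} λ k → ℚ.*-comm (s k) (t k)

∏ : ℕ → (ℕ → ℚ) → ℚ
∏ zero    f = 1ℚ
∏ (suc n) f = ∏ n f * f n

∏-head : ∀ n f → ∏ (suc n) f ≡ f 0 * ∏ n (λ k → f (suc k))
∏-head zero    f = ℚ.*-comm 1ℚ (f 0)
∏-head (suc n) f = trans (cong (_* f (suc n)) (∏-head n f)) (ℚ.*-assoc (f 0) _ (f (suc n)))

-- Fractions

/-*-/ : ∀ i j m n .{{_ : ℕ.NonZero m}} .{{_ : ℕ.NonZero n}} →
  (i / m) * (j / n) ≡ ((i ℤ.* j) / (m ℕ.* n)) {{ℕ.m*n≢0 m n}}
/-*-/ i j m@(suc m-1) n@(suc n-1) = ℚ.toℚᵘ-injective (begin-≃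
  ℚ.toℚᵘ ((i / m) * (j / n))                     ≈⟨ ℚ.toℚᵘ-homo-* (i / m) (j / n) ⟩
  ℚ.toℚᵘ (i / m) ℚᵘ.* ℚ.toℚᵘ (j / n)             ≈⟨ ℚᵘ.*-cong (ℚ.toℚᵘ-fromℚᵘ (mkℚᵘ i m-1)) (ℚ.toℚᵘ-fromℚᵘ (mkℚᵘ j n-1)) ⟩
  mkℚᵘ i m-1 ℚᵘ.* mkℚᵘ j n-1                      ≈⟨ ℚ.toℚᵘ-fromℚᵘ (mkℚᵘ i m-1 ℚᵘ.* mkℚᵘ j n-1) ⟨
  ℚ.toℚᵘ ((i ℤ.* j) / (m ℕ.* n))                  ∎-≃)
  where open ℚᵘ.≃-Reasoning renaming (begin_ to begin-≃_; _∎ to _∎-≃)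

fromℕ-* : ∀ m n → fromℕ (m ℕ.* n) ≡ fromℕ m * fromℕ n
fromℕ-* m n = trans (cong (_/ 1) (ℤ.pos-* m n)) (sym (/-*-/ (ℤ.+ m) (ℤ.+ n) 1 1))

fromℕ-+ : ∀ m n → fromℕ (m ℕ.+ n) ≡ fromℕ m + fromℕ n
fromℕ-+ m n = ℚ.toℚᵘ-injective (begin-≃
  ℚ.toℚᵘ (fromℕ (m ℕ.+ n))             ≈⟨ ℚ.toℚᵘ-fromℚᵘ (mkℚᵘ (ℤ.+ (m ℕ.+ n)) 0) ⟩
  mkℚᵘ (ℤ.+ (m ℕ.+ n)) 0               ≈⟨ ℚᵘ.*≡* (cong (ℤ._* 1ℤ) (sym (cong₂ ℤ._+_ (ℤ.*-identityʳ (ℤ.+ m)) (ℤ.*-identityʳ (ℤ.+ n))))) ⟩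
  mkℚᵘ (ℤ.+ m) 0 ℚᵘ.+ mkℚᵘ (ℤ.+ n) 0   ≈⟨ ℚᵘ.+-cong (ℚ.toℚᵘ-fromℚᵘ (mkℚᵘ (ℤ.+ m) 0)) (ℚ.toℚᵘ-fromℚᵘ (mkℚᵘ (ℤ.+ n) 0)) ⟨
  ℚ.toℚᵘ (fromℕ m) ℚᵘ.+ ℚ.toℚᵘ (fromℕ n) ≈⟨ ℚ.toℚᵘ-homo-+ (fromℕ m) (fromℕ n) ⟨
  ℚ.toℚᵘ (fromℕ m + fromℕ n)           ∎-≃)
  where open ℚᵘ.≃-Reasoning renaming (begin_ to begin-≃_; _∎ to _∎-≃)

/-*-fromℕ : ∀ i d .{{_ : ℕ.NonZero d}} → (i / d) * fromℕ d ≡ i / 1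
/-*-fromℕ i d@(suc d-1) = trans (/-*-/ i (ℤ.+ d) d 1)
  (ℚ.fromℚᵘ-cong {mkℚᵘ (i ℤ.* ℤ.+ d) (d-1 ℕ.* 1)} {mkℚᵘ i 0} (ℚᵘ.*≡*
    (trans (ℤ.*-identityʳ (i ℤ.* ℤ.+ d)) (cong (λ n → i ℤ.* ℤ.+ n) (sym (ℕ.*-identityʳ d))))))

-- Used to clear denominators: identities between fractions, and between series with equal
-- derivatives, are proved after multiplication by a positive integer.
fromℕ-*-cancelˡ : ∀ d .{{_ : ℕ.NonZero d}} {x y} → fromℕ d * x ≡ fromℕ d * y → x ≡ y
fromℕ-*-cancelˡ d {x} {y} eq = trans (sym (inverse x)) (trans (cong (ℚ.1/ fromℕ d *_) eq) (inverse y))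
  where
  instance
    d≢0 : ℚ.NonZero (fromℕ d)
    d≢0 = fromℕ-nonZero d
  inverse : ∀ z → ℚ.1/ fromℕ d * (fromℕ d * z) ≡ z
  inverse z = trans (sym (ℚ.*-assoc (ℚ.1/ fromℕ d) (fromℕ d) z))
    (trans (cong (_* z) (ℚ.*-inverseˡ (fromℕ d))) (ℚ.*-identityˡ z))

-- Determinants

sign : ℕ → ℚ
sign k = (-1ℤ ℤ.^ k) / 1

minor : ∀ {n} → Matrix (suc n) → Fin (suc n) → Matrix n
minor M j i k = M (suc i) (punchIn j k)

_≈_off_ : ∀ {n} → Matrix n → Matrix n → Fin n → Set
M ≈ N off j = ∀ i k → k ≢ j → M i k ≡ N i k

det-cong : ∀ {n} {M N : Matrix n} → (∀ i j → M i j ≡ N i j) → det n M ≡ det n N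
det-cong {zero}  M≡N = refl
det-cong {suc n} M≡N = sum-cong-≗ λ j → cong₂ (λ x d → sign (toℕ j) * x * d)
  (M≡N zero j) (det-cong λ i k → M≡N (suc i) (punchIn j k))

-- In the Laplace expansion the term of column `j` is linear through its entry, its minor being
-- common to all three matrices; every other term is linear through its minor, by induction. The
-- form x · M + N covers additivity and homogeneity at once.
det-linear : ∀ {n} {M N P : Matrix n} j x → (∀ i → P i j ≡ x * M i j + N i j) →
  M ≈ P off j → N ≈ P off j → det n P ≡ x * det n M + det n N
det-linear {suc n} {M} {N} {P} j x P≡ M≈P N≈P =
  trans (sum-cong-≗ term) (sum-linear x (λ k → s k * M zero k * det n (minor M k)) (λ k → s k * N zero k * det n (minor N k)))
  where
  distr-entry : ∀ s x m n d → s * (x * m + n) * d ≡ x * (s * m * d) + s * n * d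
  distr-entry = solve-∀ ring
  distr-minor : ∀ s p x d e → s * p * (x * d + e) ≡ x * (s * p * d) + s * p * e
  distr-minor = solve-∀ ring
  s = λ k → sign (toℕ k)
  term : ∀ k → s k * P zero k * det n (minor P k) ≡
    x * (s k * M zero k * det n (minor M k)) + s k * N zero k * det n (minor N k)
  term k with k ≟ j
  ... | yes refl = begin
    s k * P zero k * det n (minor P k)
      ≡⟨ cong (λ p → s k * p * det n (minor P k)) (P≡ zero) ⟩
    s k * (x * M zero k + N zero k) * det n (minor P k)
      ≡⟨ distr-entry (s k) x (M zero k) (N zero k) _ ⟩
    x * (s k * M zero k * det n (minor P k)) + s k * N zero k * det n (minor P k)
      ≡⟨ cong₂ (λ d e → x * (s k * M zero k * d) + s k * N zero k * e)
           (det-cong λ i l → M≈P (suc i) (punchIn k l) (punchInᵢ≢i k l))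
           (det-cong λ i l → N≈P (suc i) (punchIn k l) (punchInᵢ≢i k l)) ⟨
    x * (s k * M zero k * det n (minor M k)) + s k * N zero k * det n (minor N k) ∎
  ... | no k≢j = begin
    s k * P zero k * det n (minor P k)
      ≡⟨ cong (s k * P zero k *_) (det-linear j′ x
           (λ i → subst (λ l → P (suc i) l ≡ x * M (suc i) l + N (suc i) l) (sym k↑j′≡j) (P≡ (suc i)))
           (λ i l l≢j′ → M≈P (suc i) (punchIn k l) (k↑≢j l≢j′))
           (λ i l l≢j′ → N≈P (suc i) (punchIn k l) (k↑≢j l≢j′))) ⟩
    s k * P zero k * (x * det n (minor M k) + det n (minor N k))
      ≡⟨ distr-minor (s k) (P zero k) x _ _ ⟩
    x * (s k * P zero k * det n (minor M k)) + s k * P zero k * det n (minor N k)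
      ≡⟨ cong₂ (λ p q → x * (s k * p * det n (minor M k)) + s k * q * det n (minor N k))
           (M≈P zero k k≢j) (N≈P zero k k≢j) ⟨
    x * (s k * M zero k * det n (minor M k)) + s k * N zero k * det n (minor N k) ∎
    where
    j′ = punchOut k≢j
    k↑j′≡j : punchIn k j′ ≡ j
    k↑j′≡j = punchIn-punchOut k≢j
    k↑≢j : ∀ {l} → l ≢ j′ → punchIn k l ≢ j
    k↑≢j l≢j′ eq = l≢j′ (punchIn-injective k _ _ (trans eq (sym k↑j′≡j)))

-- A zero column is -1 times itself plus itself, so linearity suffices.
det-zero-column : ∀ {n} (M : Matrix n) j → (∀ i → M i j ≡ 0ℚ) → det n M ≡ 0ℚ
det-zero-column {n} M j M≡0 = begin
  det n M                       ≡⟨ det-linear j (- 1ℚ) column (λ _ _ _ → refl) (λ _ _ _ → refl) ⟩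
  (- 1ℚ) * det n M + det n M    ≡⟨ cancel (det n M) ⟩
  0ℚ                            ∎
  where
  cancel : ∀ d → (- 1ℚ) * d + d ≡ 0ℚ
  cancel d = trans (cong (_+ d) (trans (sym (ℚ.neg-distribˡ-* 1ℚ d)) (cong -_ (ℚ.*-identityˡ d)))) (ℚ.+-inverseˡ d)
  column : ∀ i → M i j ≡ (- 1ℚ) * M i j + M i j
  column i = trans (M≡0 i) (sym (cancel (M i j)))

-- Two neighbouring columns remain neighbours in the minor that deletes a third one.
adjacent-punchOut : ∀ {n} (k : Fin (suc (suc n))) (j : Fin (suc n)) → k ≢ inject₁ j → k ≢ suc j →
  ∃ λ j′ → punchIn k (inject₁ j′) ≡ inject₁ j × punchIn k (suc j′) ≡ suc j
adjacent-punchOut zero          zero    k≢j _ = contradiction refl k≢j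
adjacent-punchOut (suc zero)    zero    _ k≢j = contradiction refl k≢j
adjacent-punchOut {suc n} (suc (suc k)) zero    _ _ = zero , refl , refl
adjacent-punchOut zero          (suc j) _ _ = j , refl , refl
adjacent-punchOut {suc n} (suc k) (suc j) k≢j k≢1+j
  with j′ , eq , eq₁ ← adjacent-punchOut k j (k≢j ∘ cong suc) (k≢1+j ∘ cong suc)
  = suc j′ , cong suc eq , cong suc eq₁

-- The two deletions differ only at position `j`, where one leaves the right neighbour and the other
-- the left.
punchIn-adjacent : ∀ {n} (f : Fin (suc n) → ℚ) (j k : Fin n) → f (inject₁ j) ≡ f (suc j) →
  f (punchIn (inject₁ j) k) ≡ f (punchIn (suc j) k)
punchIn-adjacent f zero    zero    eq = sym eq
punchIn-adjacent f zero    (suc k) eq = refl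
punchIn-adjacent f (suc j) zero    eq = refl
punchIn-adjacent f (suc j) (suc k) eq = punchIn-adjacent (f ∘ suc) j k eq

sign-suc : ∀ k → sign (suc k) ≡ (- 1ℚ) * sign k
sign-suc k = sym (/-*-/ -1ℤ (-1ℤ ℤ.^ k) 1 1)

-- The terms of the two equal columns have equal entries and minors but opposite signs; every other
-- minor inherits two equal adjacent columns.
det-adjacent-columns : ∀ {n} (M : Matrix (suc n)) (j : Fin n) →
  (∀ i → M i (inject₁ j) ≡ M i (suc j)) → det (suc n) M ≡ 0ℚ
det-adjacent-columns {suc n} M j eq =
  sum-adjacent (λ k → s k * M zero k * det (suc n) (minor M k)) j cancel rest
  where
  s = λ k → sign (toℕ k)
  cancels : ∀ s x d → s * x * d + ((- 1ℚ) * s) * x * d ≡ 0ℚ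
  cancels = solve-∀ ring
  cancel : s (inject₁ j) * M zero (inject₁ j) * det (suc n) (minor M (inject₁ j)) +
    s (suc j) * M zero (suc j) * det (suc n) (minor M (suc j)) ≡ 0ℚ
  cancel = begin
    s (inject₁ j) * M zero (inject₁ j) * det (suc n) (minor M (inject₁ j)) +
    s (suc j) * M zero (suc j) * det (suc n) (minor M (suc j))
      ≡⟨ cong₂ _+_
           (cong₂ (λ s x → s * x * det (suc n) (minor M (inject₁ j))) (cong sign (toℕ-inject₁ j)) (eq zero))
           (cong₂ (λ s d → s * M zero (suc j) * d) (sign-suc (toℕ j))
             (det-cong λ i k → sym (punchIn-adjacent (M (suc i)) j k (eq (suc i))))) ⟩
    sign (toℕ j) * M zero (suc j) * det (suc n) (minor M (inject₁ j)) +
    (- 1ℚ) * sign (toℕ j) * M zero (suc j) * det (suc n) (minor M (inject₁ j))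
      ≡⟨ cancels (sign (toℕ j)) (M zero (suc j)) _ ⟩
    0ℚ ∎
  rest : ∀ k → k ≢ inject₁ j → k ≢ suc j → s k * M zero k * det (suc n) (minor M k) ≡ 0ℚ
  rest k k≢j k≢1+j with j′ , eq₀ , eq₁ ← adjacent-punchOut k j k≢j k≢1+j
    = trans (cong (s k * M zero k *_) (det-adjacent-columns (minor M k) j′
        (λ i → trans (cong (M (suc i)) eq₀) (trans (eq (suc i)) (cong (M (suc i)) (sym eq₁))))))
      (ℚ.*-zeroʳ (s k * M zero k))

-- Column replacement and the alternating property

infixl 20 _[_≔_]

_[_≔_] : ∀ {m n} → (Fin m → Fin n → ℚ) → Fin n → (Fin m → ℚ) → Fin m → Fin n → ℚ
(M [ j ≔ v ]) i = updateAt (M i) j λ _ → v i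

≔-updates : ∀ {m n} (M : Fin m → Fin n → ℚ) j v i → (M [ j ≔ v ]) i j ≡ v i
≔-updates M j v i = updateAt-updates j (M i)

≔-minimal : ∀ {m n} (M : Fin m → Fin n → ℚ) j v i k → k ≢ j → (M [ j ≔ v ]) i k ≡ M i k
≔-minimal M j v i k = updateAt-minimal k j (M i)

≔-cong : ∀ {n} {M N : Matrix n} j {v} → M ≈ N off j → ∀ i k → (M [ j ≔ v ]) i k ≡ (N [ j ≔ v ]) i k
≔-cong {M = M} {N} j {v} M≈N i k with k ≟ j
... | yes refl = trans (≔-updates M j v i) (sym (≔-updates N j v i))
... | no  k≢j  = trans (≔-minimal M j v i k k≢j) (trans (M≈N i k k≢j) (sym (≔-minimal N j v i k k≢j)))

≔-self : ∀ {n} (M : Matrix n) j {v} → (∀ i → M i j ≡ v i) → ∀ i k → (M [ j ≔ v ]) i k ≡ M i k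
≔-self M j {v} eq i k with k ≟ j
... | yes refl = trans (≔-updates M j v i) (sym (eq i))
... | no  k≢j  = ≔-minimal M j v i k k≢j

≔-comm : ∀ {n} (M : Matrix n) j k u v → j ≢ k → ∀ i l →
  (M [ j ≔ u ] [ k ≔ v ]) i l ≡ (M [ k ≔ v ] [ j ≔ u ]) i l
≔-comm M j k u v j≢k i = updateAt-commutes k j (j≢k ∘ sym) (M i)

det-≔-linear : ∀ {n} (M : Matrix n) j x u v →
  det n (M [ j ≔ (λ i → x * u i + v i) ]) ≡ x * det n (M [ j ≔ u ]) + det n (M [ j ≔ v ])
det-≔-linear M j x u v = det-linear j x
  (λ i → trans (≔-updates M j w i) (sym (cong₂ (λ p q → x * p + q) (≔-updates M j u i) (≔-updates M j v i))))
  (λ i k k≢j → trans (≔-minimal M j u i k k≢j) (sym (≔-minimal M j w i k k≢j)))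
  (λ i k k≢j → trans (≔-minimal M j v i k k≢j) (sym (≔-minimal M j w i k k≢j)))
  where
  w = λ i → x * u i + v i

swap-adjacent : ∀ {n} → Matrix (suc n) → Fin n → Matrix (suc n)
swap-adjacent M j = M [ inject₁ j ≔ (λ i → M i (suc j)) ] [ suc j ≔ (λ i → M i (inject₁ j)) ]

inject₁≢suc : ∀ {n} (j : Fin n) → inject₁ j ≢ suc j
inject₁≢suc (suc j) eq = inject₁≢suc j (suc-injective eq)

-- Polarization: with F u u′ the determinant as a function of the two columns, 0 = F (v + w) (v + w).
det-swap-adjacent : ∀ {n} (M : Matrix (suc n)) j → det (suc n) M ≡ (- 1ℚ) * det (suc n) (swap-adjacent M j)
det-swap-adjacent {n} M j = begin
  det (suc n) M                           ≡⟨ det-cong F-self ⟨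
  F v w                                   ≡⟨ rearrange (F v w) (F w v) ⟩
  1ℚ * (0ℚ + F w v) + (F v w + 0ℚ) + (- 1ℚ) * F w v
    ≡⟨ cong₂ (λ p q → 1ℚ * (p + F w v) + (F v w + q) + (- 1ℚ) * F w v) (F-diagonal v) (F-diagonal w) ⟨
  1ℚ * (F v v + F w v) + (F v w + F w w) + (- 1ℚ) * F w v
    ≡⟨ cong (_+ (- 1ℚ) * F w v) (cong₂ (λ p q → 1ℚ * p + q) (F-linearˡ v) (F-linearˡ w)) ⟨
  1ℚ * F s v + F s w + (- 1ℚ) * F w v     ≡⟨ cong (_+ (- 1ℚ) * F w v) (det-≔-linear (M [ j₀ ≔ s ]) j₁ 1ℚ v w) ⟨
  F s s + (- 1ℚ) * F w v                  ≡⟨ cong (_+ (- 1ℚ) * F w v) (F-diagonal s) ⟩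
  0ℚ + (- 1ℚ) * F w v                     ≡⟨ ℚ.+-identityˡ ((- 1ℚ) * F w v) ⟩
  (- 1ℚ) * F w v                          ∎
  where
  j₀ = inject₁ j
  j₁ = suc j
  v = λ i → M i j₀
  w = λ i → M i j₁
  s = λ i → 1ℚ * v i + w i
  F : (Fin (suc n) → ℚ) → (Fin (suc n) → ℚ) → ℚ
  F u u′ = det (suc n) (M [ j₀ ≔ u ] [ j₁ ≔ u′ ])
  rearrange : ∀ p q → p ≡ 1ℚ * (0ℚ + q) + (p + 0ℚ) + (- 1ℚ) * q
  rearrange = solve-∀ ring
  F-self : ∀ i k → (M [ j₀ ≔ v ] [ j₁ ≔ w ]) i k ≡ M i k
  F-self i k = trans
    (≔-self (M [ j₀ ≔ v ]) j₁ (λ i → ≔-minimal M j₀ v i j₁ (inject₁≢suc j ∘ sym)) i k)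
    (≔-self M j₀ (λ _ → refl) i k)
  F-diagonal : ∀ u → F u u ≡ 0ℚ
  F-diagonal u = det-adjacent-columns (M [ j₀ ≔ u ] [ j₁ ≔ u ]) j λ i → trans
    (trans (≔-minimal (M [ j₀ ≔ u ]) j₁ u i j₀ (inject₁≢suc j)) (≔-updates M j₀ u i))
    (sym (≔-updates (M [ j₀ ≔ u ]) j₁ u i))
  F-comm : ∀ u u′ → F u u′ ≡ det (suc n) (M [ j₁ ≔ u′ ] [ j₀ ≔ u ])
  F-comm u u′ = det-cong (≔-comm M j₀ j₁ u u′ (inject₁≢suc j))
  F-linearˡ : ∀ u → F s u ≡ F v u + F w u
  F-linearˡ u = begin
    F s u                                                ≡⟨ F-comm s u ⟩
    det (suc n) (M [ j₁ ≔ u ] [ j₀ ≔ s ])                ≡⟨ det-≔-linear (M [ j₁ ≔ u ]) j₀ 1ℚ v w ⟩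
    1ℚ * det (suc n) (M [ j₁ ≔ u ] [ j₀ ≔ v ]) + det (suc n) (M [ j₁ ≔ u ] [ j₀ ≔ w ])
      ≡⟨ cong (_+ det (suc n) (M [ j₁ ≔ u ] [ j₀ ≔ w ])) (ℚ.*-identityˡ (det (suc n) (M [ j₁ ≔ u ] [ j₀ ≔ v ]))) ⟩
    det (suc n) (M [ j₁ ≔ u ] [ j₀ ≔ v ]) + det (suc n) (M [ j₁ ≔ u ] [ j₀ ≔ w ])
      ≡⟨ cong₂ _+_ (F-comm v u) (F-comm w u) ⟨
    F v u + F w u                                        ∎

-- Induction on the number `d` of columns in between: exchanging the right copy with its left
-- neighbour brings the copies one step closer.
det-equal-columns-< : ∀ {n} d (M : Matrix n) a b → toℕ b ≡ suc (d ℕ.+ toℕ a) →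
  (∀ i → M i a ≡ M i b) → det n M ≡ 0ℚ
det-equal-columns-< zero M a (suc b) b≡1+a eq = det-adjacent-columns M b
  λ i → trans (cong (M i) (toℕ-injective (trans (toℕ-inject₁ b) (ℕ.suc-injective b≡1+a)))) (eq i)
det-equal-columns-< {suc n} (suc d) M a (suc b) b≡2+d+a eq = begin
  det (suc n) M                                  ≡⟨ det-swap-adjacent M b ⟩
  (- 1ℚ) * det (suc n) (swap-adjacent M b)       ≡⟨ cong ((- 1ℚ) *_) (det-equal-columns-< d (swap-adjacent M b) a b₀ b₀≡1+d+a eq′) ⟩
  (- 1ℚ) * 0ℚ                                    ∎
  where
  b₀ = inject₁ b
  v = λ i → M i b₀
  w = λ i → M i (suc b)
  b₀≡1+d+a : toℕ b₀ ≡ suc (d ℕ.+ toℕ a)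
  b₀≡1+d+a = trans (toℕ-inject₁ b) (ℕ.suc-injective b≡2+d+a)
  a≢b₀ : a ≢ b₀
  a≢b₀ refl = ℕ.m≢1+n+m (toℕ a) {d} b₀≡1+d+a
  a≢1+b : a ≢ suc b
  a≢1+b refl = ℕ.m≢1+n+m (toℕ a) {suc d} b≡2+d+a
  eq′ : ∀ i → swap-adjacent M b i a ≡ swap-adjacent M b i b₀
  eq′ i = begin
    swap-adjacent M b i a      ≡⟨ ≔-minimal (M [ b₀ ≔ w ]) (suc b) v i a a≢1+b ⟩
    (M [ b₀ ≔ w ]) i a         ≡⟨ ≔-minimal M b₀ w i a a≢b₀ ⟩
    M i a                      ≡⟨ eq i ⟩
    M i (suc b)                ≡⟨ ≔-updates M b₀ w i ⟨
    (M [ b₀ ≔ w ]) i b₀        ≡⟨ ≔-minimal (M [ b₀ ≔ w ]) (suc b) v i b₀ (inject₁≢suc b) ⟨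
    swap-adjacent M b i b₀     ∎

<⇒∸-suc : ∀ {m n} → m ℕ.< n → n ≡ suc (n ℕ.∸ suc m ℕ.+ m)
<⇒∸-suc {m} {n} m<n = trans (sym (ℕ.m∸n+n≡m m<n)) (ℕ.+-suc (n ℕ.∸ suc m) m)

det-equal-columns : ∀ {n} (M : Matrix n) a b → a ≢ b → (∀ i → M i a ≡ M i b) → det n M ≡ 0ℚ
det-equal-columns M a b a≢b eq with ℕ.<-cmp (toℕ a) (toℕ b)
... | tri< a<b _ _ = det-equal-columns-< (toℕ b ℕ.∸ suc (toℕ a)) M a b (<⇒∸-suc a<b) eq
... | tri≈ _ a≡b _ = contradiction (toℕ-injective a≡b) a≢b
... | tri> _ _ b<a = det-equal-columns-< (toℕ a ℕ.∸ suc (toℕ b)) M b a (<⇒∸-suc b<a) (sym ∘ eq)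

det-≔-sum : ∀ {m n} (M : Matrix n) j (w : Fin m → Fin n → ℚ) (a : Fin m → ℚ) →
  det n (M [ j ≔ (λ i → ∑[ k < m ] (a k * w k i)) ]) ≡ ∑[ k < m ] (a k * det n (M [ j ≔ w k ]))
det-≔-sum {zero}  {n} M j w a = det-zero-column (M [ j ≔ (λ _ → 0ℚ) ]) j (≔-updates M j λ _ → 0ℚ)
det-≔-sum {suc m} {n} M j w a = trans
  (det-≔-linear M j (a zero) (w zero) (λ i → ∑[ k < m ] (a (suc k) * w (suc k) i)))
  (cong (a zero * det n (M [ j ≔ w zero ]) +_) (det-≔-sum M j (λ k → w (suc k)) (λ k → a (suc k))))

-- Cramer's rule: expanding the j-th column, only the term k = j has no repeated column.
det-column-combination : ∀ {n} (M N : Matrix n) j (a : Fin n → ℚ) → (∀ i → M i j ≡ ∑[ k < n ] (a k * N i k)) →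
  M ≈ N off j → det n M ≡ a j * det n N
det-column-combination {n} M N j a M≡ M≈C = begin
  det n M
    ≡⟨ det-cong (≔-self M j M≡) ⟨
  det n (M [ j ≔ (λ i → ∑[ k < n ] (a k * N i k)) ])
    ≡⟨ det-cong (≔-cong j M≈C) ⟩
  det n (N [ j ≔ (λ i → ∑[ k < n ] (a k * N i k)) ])
    ≡⟨ det-≔-sum N j (λ k i → N i k) a ⟩
  ∑[ k < n ] (a k * det n (N [ j ≔ (λ i → N i k) ]))
    ≡⟨ sum-single (λ k → a k * det n (N [ j ≔ (λ i → N i k) ])) j (λ k k≢j → trans (cong (a k *_) (repeated k k≢j)) (ℚ.*-zeroʳ (a k))) ⟩
  a j * det n (N [ j ≔ (λ i → N i j) ])
    ≡⟨ cong (a j *_) (det-cong (≔-self N j (λ _ → refl))) ⟩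
  a j * det n N ∎
  where
  repeated : ∀ k → k ≢ j → det n (N [ j ≔ (λ i → N i k) ]) ≡ 0ℚ
  repeated k k≢j = det-equal-columns (N [ j ≔ (λ i → N i k) ]) k j k≢j λ i →
    trans (≔-minimal N j (λ i → N i k) i k k≢j) (sym (≔-updates N j (λ i → N i k) i))

-- Triangular matrices and removal of a triangular factor

restrict : ∀ n → (ℕ → ℕ → ℚ) → Matrix n
restrict n M i j = M (toℕ i) (toℕ j)

det-lower-triangular : ∀ n (M : ℕ → ℕ → ℚ) → (∀ i k → i ℕ.< k → M i k ≡ 0ℚ) →
  det n (restrict n M) ≡ ∏ n (λ k → M k k)
det-lower-triangular zero    M M≡0 = refl
det-lower-triangular (suc n) M M≡0 = begin
  1ℚ * M 0 0 * det n (restrict n M′) + sum rest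
    ≡⟨ cong₂ (λ d t → 1ℚ * M 0 0 * d + t) (det-lower-triangular n M′ λ i k i<k → M≡0 (suc i) (suc k) (s≤s i<k)) (sum-zero rest rest≡0) ⟩
  1ℚ * M 0 0 * ∏ n (λ k → M′ k k) + 0ℚ
    ≡⟨ simplify (M 0 0) (∏ n (λ k → M′ k k)) ⟩
  M 0 0 * ∏ n (λ k → M′ k k)
    ≡⟨ ∏-head n (λ k → M k k) ⟨
  ∏ (suc n) (λ k → M k k) ∎
  where
  M′ : ℕ → ℕ → ℚ
  M′ i k = M (suc i) (suc k)
  simplify : ∀ x p → 1ℚ * x * p + 0ℚ ≡ x * p
  simplify = solve-∀ ring
  rest : Fin n → ℚ
  rest k = sign (suc (toℕ k)) * M 0 (suc (toℕ k)) * det n (minor (restrict (suc n) M) (suc k))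
  rest≡0 : ∀ k → rest k ≡ 0ℚ
  rest≡0 k = trans
    (cong (λ x → sign (suc (toℕ k)) * x * det n (minor (restrict (suc n) M) (suc k))) (M≡0 0 (suc (toℕ k)) (s≤s z≤n)))
    (vanish (sign (suc (toℕ k))) _)
    where
    vanish : ∀ s d → s * 0ℚ * d ≡ 0ℚ
    vanish = solve-∀ ring

splice : ℕ → (N M : ℕ → ℕ → ℚ) → ℕ → ℕ → ℚ
splice s N M i j with j ℕ.<? s
... | yes _ = N i j
... | no  _ = M i j

splice-< : ∀ s N M i {j} → j ℕ.< s → splice s N M i j ≡ N i j
splice-< s N M i {j} j<s with j ℕ.<? s
... | yes _   = refl
... | no  j≮s = contradiction j<s j≮s

splice-≥ : ∀ s N M i {j} → s ℕ.≤ j → splice s N M i j ≡ M i j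
splice-≥ s N M i {j} s≤j with j ℕ.<? s
... | yes j<s = contradiction s≤j (ℕ.<⇒≱ j<s)
... | no  _   = refl

-- The columns of M are replaced by those of N one at a time, from the left.
det-*-upper-triangular : ∀ n (M N U : ℕ → ℕ → ℚ) →
  (∀ i j → i ℕ.< n → j ℕ.< n → M i j ≡ ∑[ k < n ] (U (toℕ k) j * N i (toℕ k))) →
  (∀ k j → j ℕ.< k → U k j ≡ 0ℚ) →
  det n (restrict n M) ≡ ∏ n (λ k → U k k) * det n (restrict n N)
det-*-upper-triangular n M N U M≡NU U≡0 = trans (replace n ℕ.≤-refl)
  (cong (∏ n (λ k → U k k) *_) (det-cong λ i j → splice-< n N M (toℕ i) (toℕ<n j)))
  where
  step : ∀ s → s ℕ.< n →
    det n (restrict n (splice s N M)) ≡ U s s * det n (restrict n (splice (suc s) N M))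
  step s s<n = trans
    (det-column-combination (restrict n (splice s N M)) (restrict n (splice (suc s) N M)) j
      (λ k → U (toℕ k) s) column off)
    (cong (λ k → U k s * det n (restrict n (splice (suc s) N M))) j≡s)
    where
    j = fromℕ< s<n
    j≡s : toℕ j ≡ s
    j≡s = toℕ-fromℕ< s<n
    -- For `k` ≤ `s` the next hybrid already has the column of `N`; for larger `k` the coefficient
    -- `U k s` is zero. So column `s` of `M` combines columns of that hybrid, and the Cramer step
    -- contributes the factor `U s s`.
    term : ∀ i k → U k s * N i k ≡ U k s * splice (suc s) N M i k
    term i k with k ℕ.≤? s
    ... | yes k≤s = cong (U k s *_) (sym (splice-< (suc s) N M i (s≤s k≤s)))
    ... | no  k≰s = trans (vanish (N i k)) (sym (vanish (splice (suc s) N M i k)))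
      where
      vanish : ∀ x → U k s * x ≡ 0ℚ
      vanish x = trans (cong (_* x) (U≡0 k s (ℕ.≰⇒> k≰s))) (ℚ.*-zeroˡ x)
    column : ∀ i → splice s N M (toℕ i) (toℕ j) ≡ ∑[ k < n ] (U (toℕ k) s * splice (suc s) N M (toℕ i) (toℕ k))
    column i = begin
      splice s N M (toℕ i) (toℕ j) ≡⟨ cong (splice s N M (toℕ i)) j≡s ⟩
      splice s N M (toℕ i) s       ≡⟨ splice-≥ s N M (toℕ i) ℕ.≤-refl ⟩
      M (toℕ i) s                  ≡⟨ M≡NU (toℕ i) s (toℕ<n i) s<n ⟩
      ∑[ k < n ] (U (toℕ k) s * N (toℕ i) (toℕ k))
        ≡⟨ sum-cong-≗ {n} (λ k → term (toℕ i) (toℕ k)) ⟩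
      ∑[ k < n ] (U (toℕ k) s * splice (suc s) N M (toℕ i) (toℕ k)) ∎
    off : restrict n (splice s N M) ≈ restrict n (splice (suc s) N M) off j
    off i l l≢j with ℕ.<-cmp (toℕ l) s
    ... | tri< l<s _ _ = trans (splice-< s N M (toℕ i) l<s) (sym (splice-< (suc s) N M (toℕ i) (ℕ.m<n⇒m<1+n l<s)))
    ... | tri≈ _ l≡s _ = contradiction (toℕ-injective (trans l≡s (sym j≡s))) l≢j
    ... | tri> _ _ s<l = trans (splice-≥ s N M (toℕ i) (ℕ.<⇒≤ s<l)) (sym (splice-≥ (suc s) N M (toℕ i) s<l))
  replace : ∀ s → s ℕ.≤ n →
    det n (restrict n M) ≡ ∏ s (λ k → U k k) * det n (restrict n (splice s N M))
  replace zero    _   = sym (trans (ℚ.*-identityˡ (det n (restrict n (splice 0 N M))))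
    (det-cong {n} λ i j → splice-≥ 0 N M (toℕ i) {toℕ j} z≤n))
  replace (suc s) s<n = begin
    det n (restrict n M)
      ≡⟨ replace s (ℕ.<⇒≤ s<n) ⟩
    ∏ s (λ k → U k k) * det n (restrict n (splice s N M))
      ≡⟨ cong (∏ s (λ k → U k k) *_) (step s s<n) ⟩
    ∏ s (λ k → U k k) * (U s s * det n (restrict n (splice (suc s) N M)))
      ≡⟨ ℚ.*-assoc (∏ s (λ k → U k k)) (U s s) (det n (restrict n (splice (suc s) N M))) ⟨
    ∏ (suc s) (λ k → U k k) * det n (restrict n (splice (suc s) N M)) ∎

-- Formal power series

deriv : Series → Series
deriv f n = fromℕ (suc n) * f (suc n)

exp-*-! : ∀ c n → exp c n * fromℕ (n !) ≡ (c ℤ.^ n) / 1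
exp-*-! c n = /-*-fromℕ (c ℤ.^ n) (n !) {{n ℕ.!≢0}}

deriv-exp : ∀ c n → deriv (exp c) n ≡ (c / 1) * exp c n
deriv-exp c n = fromℕ-*-cancelˡ (n !) {{n ℕ.!≢0}} (begin
  fromℕ (n !) * (fromℕ (suc n) * exp c (suc n))   ≡⟨ rearrange (fromℕ (n !)) (fromℕ (suc n)) (exp c (suc n)) ⟩
  exp c (suc n) * (fromℕ (suc n) * fromℕ (n !))   ≡⟨ cong (exp c (suc n) *_) (fromℕ-* (suc n) (n !)) ⟨
  exp c (suc n) * fromℕ (suc n !)                 ≡⟨ exp-*-! c (suc n) ⟩
  (c ℤ.^ suc n) / 1                               ≡⟨ /-*-/ c (c ℤ.^ n) 1 1 ⟨
  (c / 1) * ((c ℤ.^ n) / 1)                       ≡⟨ cong (c / 1 *_) (exp-*-! c n) ⟨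
  (c / 1) * (exp c n * fromℕ (n !))               ≡⟨ rearrange′ (c / 1) (exp c n) (fromℕ (n !)) ⟩
  fromℕ (n !) * ((c / 1) * exp c n)               ∎)
  where
  rearrange : ∀ x y z → x * (y * z) ≡ z * (y * x)
  rearrange = solve-∀ ring
  rearrange′ : ∀ x y z → x * (y * z) ≡ z * (x * y)
  rearrange′ = solve-∀ ring

⊛-cong : ∀ {f f′ g g′ : Series} → f ≗ f′ → g ≗ g′ → f ⊛ g ≗ f′ ⊛ g′
⊛-cong f≗f′ g≗g′ n = sum-cong-≗ {suc n} λ i → cong₂ _*_ (f≗f′ (toℕ i)) (g≗g′ (n ℕ.∸ toℕ i))

⊛-linearˡ : ∀ x y (f f′ g : Series) → (λ n → x * f n + y * f′ n) ⊛ g ≗ λ n → x * (f ⊛ g) n + y * (f′ ⊛ g) n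
⊛-linearˡ x y f f′ g n = begin
  ∑[ i < suc n ] ((x * f (toℕ i) + y * f′ (toℕ i)) * g (n ℕ.∸ toℕ i))
    ≡⟨ sum-cong-≗ {suc n} (λ i → distr (f (toℕ i)) (f′ (toℕ i)) (g (n ℕ.∸ toℕ i)) x y) ⟩
  ∑[ i < suc n ] (x * (f (toℕ i) * g (n ℕ.∸ toℕ i)) + y * (f′ (toℕ i) * g (n ℕ.∸ toℕ i)))
    ≡⟨ sum-linear {suc n} x (λ i → f (toℕ i) * g (n ℕ.∸ toℕ i)) (λ i → y * (f′ (toℕ i) * g (n ℕ.∸ toℕ i))) ⟩
  x * (f ⊛ g) n + ∑[ i < suc n ] (y * (f′ (toℕ i) * g (n ℕ.∸ toℕ i)))
    ≡⟨ cong (x * (f ⊛ g) n +_) (*-distribˡ-sum {suc n} y (λ i → f′ (toℕ i) * g (n ℕ.∸ toℕ i))) ⟨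
  x * (f ⊛ g) n + y * (f′ ⊛ g) n ∎
  where
  distr : ∀ p q r x y → (x * p + y * q) * r ≡ x * (p * r) + y * (q * r)
  distr = solve-∀ ring

⊛-tailʳ : ∀ (f g : Series) → g 0 ≡ 0ℚ → ∀ n → (f ⊛ g) (suc n) ≡ (f ⊛ (λ k → g (suc k))) n
⊛-tailʳ f g g₀≡0 zero = cong (f 0 * g 1 +_) (trans (ℚ.+-identityʳ (f 1 * g 0)) (trans (cong (f 1 *_) g₀≡0) (ℚ.*-zeroʳ (f 1))))
⊛-tailʳ f g g₀≡0 (suc n) = cong (f 0 * g (suc (suc n)) +_) (⊛-tailʳ (λ k → f (suc k)) g g₀≡0 n)

-- Leibniz's rule is a termwise identity for the derivation t · d/dt.
deriv-⊛ : ∀ (f g : Series) n → deriv (f ⊛ g) n ≡ (deriv f ⊛ g) n + (f ⊛ deriv g) n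
deriv-⊛ f g n = begin
  fromℕ (suc n) * (f ⊛ g) (suc n)
    ≡⟨ θ-⊛ (suc n) ⟩
  (θ f ⊛ g) (suc n) + (f ⊛ θ g) (suc n)
    ≡⟨ cong₂ _+_ (trans (cong (λ x → x * g (suc n) + (deriv f ⊛ g) n) (ℚ.*-zeroˡ (f 0))) (drop (g (suc n)) ((deriv f ⊛ g) n)))
         (⊛-tailʳ f (θ g) (ℚ.*-zeroˡ (g 0)) n) ⟩
  (deriv f ⊛ g) n + (f ⊛ deriv g) n ∎
  where
  θ : Series → Series
  θ f k = fromℕ k * f k
  drop : ∀ x y → 0ℚ * x + y ≡ y
  drop = solve-∀ ring
  distr : ∀ p q x y → (x + y) * (p * q) ≡ x * p * q + p * (y * q)
  distr = solve-∀ ring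
  θ-⊛ : ∀ m → fromℕ m * (f ⊛ g) m ≡ (θ f ⊛ g) m + (f ⊛ θ g) m
  θ-⊛ m = begin
    fromℕ m * (f ⊛ g) m
      ≡⟨ *-distribˡ-sum {suc m} (fromℕ m) (λ i → f (toℕ i) * g (m ℕ.∸ toℕ i)) ⟩
    ∑[ i < suc m ] (fromℕ m * (f (toℕ i) * g (m ℕ.∸ toℕ i)))
      ≡⟨ sum-cong-≗ {suc m} term ⟩
    ∑[ i < suc m ] (θ f (toℕ i) * g (m ℕ.∸ toℕ i) + f (toℕ i) * θ g (m ℕ.∸ toℕ i))
      ≡⟨ ∑-distrib-+ {suc m} (λ i → θ f (toℕ i) * g (m ℕ.∸ toℕ i)) (λ i → f (toℕ i) * θ g (m ℕ.∸ toℕ i)) ⟩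
    (θ f ⊛ g) m + (f ⊛ θ g) m ∎
    where
    term : ∀ (i : Fin (suc m)) → fromℕ m * (f (toℕ i) * g (m ℕ.∸ toℕ i)) ≡
      θ f (toℕ i) * g (m ℕ.∸ toℕ i) + f (toℕ i) * θ g (m ℕ.∸ toℕ i)
    term i = trans
      (cong (_* (f (toℕ i) * g (m ℕ.∸ toℕ i)))
        (trans (cong fromℕ (sym (ℕ.m+[n∸m]≡n (ℕ.s≤s⁻¹ (toℕ<n i))))) (fromℕ-+ (toℕ i) (m ℕ.∸ toℕ i))))
      (distr (f (toℕ i)) (g (m ℕ.∸ toℕ i)) (fromℕ (toℕ i)) (fromℕ (m ℕ.∸ toℕ i)))

-- Follows the recursion of `_⊘_`: the first quotient digit is `f 0`, and the remainder (h - f₀ g) /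
-- t is the tail of `f` times `g`.
⊘-unique : ∀ (f g h : Series) .{{_ : ℚ.NonZero (g 0)}} → f ⊛ g ≗ h → h ⊘ g ≗ f
⊘-unique f g h fg≗h = go
  where
  quotient₀ : h 0 ℚ.÷ g 0 ≡ f 0
  quotient₀ = begin
    h 0 * ℚ.1/ g 0                   ≡⟨ cong (_* ℚ.1/ g 0) (fg≗h 0) ⟨
    (f 0 * g 0 + 0ℚ) * ℚ.1/ g 0      ≡⟨ cong (_* ℚ.1/ g 0) (ℚ.+-identityʳ (f 0 * g 0)) ⟩
    f 0 * g 0 * ℚ.1/ g 0             ≡⟨ ℚ.*-assoc (f 0) (g 0) (ℚ.1/ g 0) ⟩
    f 0 * (g 0 * ℚ.1/ g 0)           ≡⟨ cong (f 0 *_) (ℚ.*-inverseʳ (g 0)) ⟩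
    f 0 * 1ℚ                         ≡⟨ ℚ.*-identityʳ (f 0) ⟩
    f 0                              ∎
  cancel : ∀ x y → y ≡ x + y + - x
  cancel = solve-∀ ring
  go : h ⊘ g ≗ f
  go zero    = quotient₀
  go (suc n) = ⊘-unique (λ k → f (suc k)) g (λ k → h (suc k) ℚ.- (h 0 ℚ.÷ g 0) * g (suc k)) (λ k → begin
    ((λ k → f (suc k)) ⊛ g) k
      ≡⟨ cancel (f 0 * g (suc k)) _ ⟩
    (f ⊛ g) (suc k) + - (f 0 * g (suc k))
      ≡⟨ cong₂ (λ p q → p + - (q * g (suc k))) (fg≗h (suc k)) (sym quotient₀) ⟩
    h (suc k) ℚ.- (h 0 ℚ.÷ g 0) * g (suc k) ∎) n

-- The triangle of sech · tanhᵏ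

-- A n k is n! times the coefficient of tⁿ in sech t · tanhᵏ t; the recurrence is the derivative of that function.
A : ℕ → ℕ → ℚ
A zero    zero    = 1ℚ
A zero    (suc k) = 0ℚ
-- At `k` = 0 the truncated predecessor is harmless, its coefficient being 0.
A (suc n) k       = fromℕ k * A n (ℕ.pred k) + - (fromℕ (suc k) * A n (suc k))

-- The factor `exp 1ℤ n` is 1 / n!. As `exp 1ℤ` is its own derivative, differentiation merely shifts
-- the first index of `A`.
sech·tanh^ : ℕ → Series
sech·tanh^ k n = A n k * exp 1ℤ n

2cosh 2sinh : Series
2cosh = exp 1ℤ ⊕ exp -1ℤ
2sinh n = exp 1ℤ n + (- 1ℚ) * exp -1ℤ n

deriv-exp₊ : deriv (exp 1ℤ) ≗ exp 1ℤ
deriv-exp₊ n = trans (deriv-exp 1ℤ n) (ℚ.*-identityˡ (exp 1ℤ n))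

deriv-2cosh : deriv 2cosh ≗ 2sinh
deriv-2cosh n = trans (ℚ.*-distribˡ-+ (fromℕ (suc n)) (exp 1ℤ (suc n)) (exp -1ℤ (suc n)))
  (cong₂ _+_ (deriv-exp₊ n) (deriv-exp -1ℤ n))

deriv-2sinh : deriv 2sinh ≗ 2cosh
deriv-2sinh n = begin
  fromℕ (suc n) * (exp 1ℤ (suc n) + (- 1ℚ) * exp -1ℤ (suc n))
    ≡⟨ distr (fromℕ (suc n)) (exp 1ℤ (suc n)) (exp -1ℤ (suc n)) ⟩
  deriv (exp 1ℤ) n + (- 1ℚ) * deriv (exp -1ℤ) n
    ≡⟨ cong₂ (λ p q → p + (- 1ℚ) * q) (deriv-exp₊ n) (deriv-exp -1ℤ n) ⟩
  exp 1ℤ n + (- 1ℚ) * ((- 1ℚ) * exp -1ℤ n)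
    ≡⟨ cong (exp 1ℤ n +_) (double (exp -1ℤ n)) ⟩
  2cosh n ∎
  where
  distr : ∀ x p q → x * (p + (- 1ℚ) * q) ≡ x * p + (- 1ℚ) * (x * q)
  distr = solve-∀ ring
  double : ∀ x → (- 1ℚ) * ((- 1ℚ) * x) ≡ x
  double = solve-∀ ring

deriv-sech·tanh^ : ∀ k → deriv (sech·tanh^ k) ≗ λ n → fromℕ k * sech·tanh^ (ℕ.pred k) n + (- fromℕ (suc k)) * sech·tanh^ (suc k) n
deriv-sech·tanh^ k n = begin
  fromℕ (suc n) * (A (suc n) k * exp 1ℤ (suc n))
    ≡⟨ rearrange (fromℕ (suc n)) (A (suc n) k) (exp 1ℤ (suc n)) ⟩
  A (suc n) k * deriv (exp 1ℤ) n
    ≡⟨ cong (A (suc n) k *_) (deriv-exp₊ n) ⟩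
  A (suc n) k * exp 1ℤ n
    ≡⟨ distr (fromℕ k) (A n (ℕ.pred k)) (fromℕ (suc k)) (A n (suc k)) (exp 1ℤ n) ⟩
  fromℕ k * sech·tanh^ (ℕ.pred k) n + (- fromℕ (suc k)) * sech·tanh^ (suc k) n ∎
  where
  rearrange : ∀ x y z → x * (y * z) ≡ y * (x * z)
  rearrange = solve-∀ ring
  distr : ∀ x a y b e → (x * a + - (y * b)) * e ≡ x * (a * e) + (- y) * (b * e)
  distr = solve-∀ ring

deriv-sech·tanh^-⊛ : ∀ k (g : Series) n → deriv (sech·tanh^ k ⊛ g) n ≡
  fromℕ k * (sech·tanh^ (ℕ.pred k) ⊛ g) n + (- fromℕ (suc k)) * (sech·tanh^ (suc k) ⊛ g) n + (sech·tanh^ k ⊛ deriv g) n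
deriv-sech·tanh^-⊛ k g n = begin
  deriv (sech·tanh^ k ⊛ g) n                       ≡⟨ deriv-⊛ (sech·tanh^ k) g n ⟩
  (deriv (sech·tanh^ k) ⊛ g) n + (sech·tanh^ k ⊛ deriv g) n     ≡⟨ cong (_+ (sech·tanh^ k ⊛ deriv g) n) (⊛-cong {g = g} (deriv-sech·tanh^ k) (λ _ → refl) n) ⟩
  ((λ m → fromℕ k * sech·tanh^ (ℕ.pred k) m + (- fromℕ (suc k)) * sech·tanh^ (suc k) m) ⊛ g) n + (sech·tanh^ k ⊛ deriv g) n
    ≡⟨ cong (_+ (sech·tanh^ k ⊛ deriv g) n) (⊛-linearˡ (fromℕ k) (- fromℕ (suc k)) (sech·tanh^ (ℕ.pred k)) (sech·tanh^ (suc k)) g n) ⟩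
  fromℕ k * (sech·tanh^ (ℕ.pred k) ⊛ g) n + (- fromℕ (suc k)) * (sech·tanh^ (suc k) ⊛ g) n + (sech·tanh^ k ⊛ deriv g) n ∎

-- This vanishes because sech · tanhᵏ · sinh = sech · tanhᵏ⁺¹ · cosh. For the series defined by A, that follows
-- from the linear system of differential equations below, with zero initial values.
defect : ℕ → Series
defect k n = (sech·tanh^ k ⊛ 2sinh) n + (- 1ℚ) * (sech·tanh^ (suc k) ⊛ 2cosh) n

deriv-defect : ∀ k n → deriv (defect k) n ≡ fromℕ k * defect (ℕ.pred k) n + (- fromℕ (2 ℕ.+ k)) * defect (suc k) n
deriv-defect k n = begin
  fromℕ (suc n) * ((sech·tanh^ k ⊛ 2sinh) (suc n) + (- 1ℚ) * (sech·tanh^ (suc k) ⊛ 2cosh) (suc n))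
    ≡⟨ distr (fromℕ (suc n)) ((sech·tanh^ k ⊛ 2sinh) (suc n)) ((sech·tanh^ (suc k) ⊛ 2cosh) (suc n)) ⟩
  deriv (sech·tanh^ k ⊛ 2sinh) n + (- 1ℚ) * deriv (sech·tanh^ (suc k) ⊛ 2cosh) n
    ≡⟨ cong₂ (λ p q → p + (- 1ℚ) * q) (deriv-sech·tanh^-⊛ k 2sinh n) (deriv-sech·tanh^-⊛ (suc k) 2cosh n) ⟩
  x * a + (- fromℕ (suc k)) * e + (sech·tanh^ k ⊛ deriv 2sinh) n +
  (- 1ℚ) * (fromℕ (suc k) * c + (- fromℕ (2 ℕ.+ k)) * d + (sech·tanh^ (suc k) ⊛ deriv 2cosh) n)
    ≡⟨ cong₂ (λ p q → x * a + (- fromℕ (suc k)) * e + p + (- 1ℚ) * (fromℕ (suc k) * c + (- fromℕ (2 ℕ.+ k)) * d + q))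
         (⊛-cong {sech·tanh^ k} (λ _ → refl) deriv-2sinh n) (⊛-cong {sech·tanh^ (suc k)} (λ _ → refl) deriv-2cosh n) ⟩
  x * a + (- fromℕ (suc k)) * e + c + (- 1ℚ) * (fromℕ (suc k) * c + (- fromℕ (2 ℕ.+ k)) * d + e)
    ≡⟨ cong₂ (λ y z → x * a + (- y) * e + c + (- 1ℚ) * (y * c + (- z) * d + e))
         (fromℕ-+ 1 k) (fromℕ-+ 2 k) ⟩
  x * a + (- (1ℚ + x)) * e + c + (- 1ℚ) * ((1ℚ + x) * c + (- (fromℕ 2 + x)) * d + e)
    -- The mixed terms fit: `c` gets 1 - (1 + k) = -k and `e` gets -(1 + k) - 1 = -(k + 2), which
    -- pair with `a` and `d` into two defects.
    ≡⟨ collect x a e c d ⟩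
  x * a + (- 1ℚ) * (x * c) + (- (fromℕ 2 + x)) * (e + (- 1ℚ) * d)
    ≡⟨ cong₂ (λ p q → x * a + (- 1ℚ) * p + (- q) * (e + (- 1ℚ) * d)) (shift k) (sym (fromℕ-+ 2 k)) ⟩
  x * a + (- 1ℚ) * (x * (sech·tanh^ (suc (ℕ.pred k)) ⊛ 2cosh) n) + (- fromℕ (2 ℕ.+ k)) * defect (suc k) n
    ≡⟨ cong (_+ (- fromℕ (2 ℕ.+ k)) * defect (suc k) n) (factor x a ((sech·tanh^ (suc (ℕ.pred k)) ⊛ 2cosh) n)) ⟩
  x * defect (ℕ.pred k) n + (- fromℕ (2 ℕ.+ k)) * defect (suc k) n ∎
  where
  x = fromℕ k
  a = (sech·tanh^ (ℕ.pred k) ⊛ 2sinh) n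
  e = (sech·tanh^ (suc k) ⊛ 2sinh) n
  c = (sech·tanh^ k ⊛ 2cosh) n
  d = (sech·tanh^ (2 ℕ.+ k) ⊛ 2cosh) n
  distr : ∀ x p q → x * (p + (- 1ℚ) * q) ≡ x * p + (- 1ℚ) * (x * q)
  distr = solve-∀ ring
  factor : ∀ x p q → x * p + (- 1ℚ) * (x * q) ≡ x * (p + (- 1ℚ) * q)
  factor = solve-∀ ring
  collect : ∀ x a b c d →
    x * a + (- (1ℚ + x)) * b + c + (- 1ℚ) * ((1ℚ + x) * c + (- (fromℕ 2 + x)) * d + b) ≡
    x * a + (- 1ℚ) * (x * c) + (- (fromℕ 2 + x)) * (b + (- 1ℚ) * d)
  collect = solve-∀ ring
  -- The indices differ only at `k` = 0, where both sides carry the factor 0.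
  shift : ∀ k → fromℕ k * (sech·tanh^ k ⊛ 2cosh) n ≡ fromℕ k * (sech·tanh^ (suc (ℕ.pred k)) ⊛ 2cosh) n
  shift zero    = trans (ℚ.*-zeroˡ ((sech·tanh^ 0 ⊛ 2cosh) n)) (sym (ℚ.*-zeroˡ ((sech·tanh^ 1 ⊛ 2cosh) n)))
  shift (suc k) = refl

-- All `k` are treated at once, because coefficient n + 1 of one defect is determined by coefficient
-- n of the two neighbouring defects.
defect≡0 : ∀ n k → defect k n ≡ 0ℚ
defect≡0 zero k = initial (A 0 k)
  where
  initial : ∀ x → x * 1ℚ * 0ℚ + 0ℚ + (- 1ℚ) * (0ℚ * 1ℚ * fromℕ 2 + 0ℚ) ≡ 0ℚ
  initial = solve-∀ ring
defect≡0 (suc n) k = fromℕ-*-cancelˡ (suc n) (begin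
  deriv (defect k) n
    ≡⟨ deriv-defect k n ⟩
  fromℕ k * defect (ℕ.pred k) n + (- fromℕ (2 ℕ.+ k)) * defect (suc k) n
    ≡⟨ cong₂ (λ p q → fromℕ k * p + (- fromℕ (2 ℕ.+ k)) * q) (defect≡0 n (ℕ.pred k)) (defect≡0 n (suc k)) ⟩
  fromℕ k * 0ℚ + (- fromℕ (2 ℕ.+ k)) * 0ℚ
    ≡⟨ vanish (fromℕ k) (fromℕ (2 ℕ.+ k)) (fromℕ (suc n)) ⟩
  fromℕ (suc n) * 0ℚ ∎)
  where
  vanish : ∀ x y z → x * 0ℚ + (- y) * 0ℚ ≡ z * 0ℚ
  vanish = solve-∀ ring

-- The derivative of this product is `defect 0`, hence zero, so only the constant term survives.
sech-⊛-2cosh : sech·tanh^ 0 ⊛ 2cosh ≗ const (fromℕ 2)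
sech-⊛-2cosh zero    = refl
sech-⊛-2cosh (suc n) = fromℕ-*-cancelˡ (suc n) (begin
  deriv (sech·tanh^ 0 ⊛ 2cosh) n
    ≡⟨ deriv-sech·tanh^-⊛ 0 2cosh n ⟩
  0ℚ * (sech·tanh^ 0 ⊛ 2cosh) n + (- 1ℚ) * (sech·tanh^ 1 ⊛ 2cosh) n + (sech·tanh^ 0 ⊛ deriv 2cosh) n
    ≡⟨ cong (0ℚ * (sech·tanh^ 0 ⊛ 2cosh) n + (- 1ℚ) * (sech·tanh^ 1 ⊛ 2cosh) n +_) (⊛-cong {sech·tanh^ 0} (λ _ → refl) deriv-2cosh n) ⟩
  0ℚ * (sech·tanh^ 0 ⊛ 2cosh) n + (- 1ℚ) * (sech·tanh^ 1 ⊛ 2cosh) n + (sech·tanh^ 0 ⊛ 2sinh) n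
    ≡⟨ reorder ((sech·tanh^ 0 ⊛ 2cosh) n) ((sech·tanh^ 1 ⊛ 2cosh) n) ((sech·tanh^ 0 ⊛ 2sinh) n) ⟩
  defect 0 n
    ≡⟨ defect≡0 n 0 ⟩
  0ℚ
    ≡⟨ ℚ.*-zeroʳ (fromℕ (suc n)) ⟨
  fromℕ (suc n) * 0ℚ ∎)
  where
  reorder : ∀ p q r → 0ℚ * p + (- 1ℚ) * q + r ≡ r + (- 1ℚ) * q
  reorder = solve-∀ ring

E≡A : ∀ n → E n ≡ A n 0
E≡A n = begin
  fromℕ (n !) * (const (fromℕ 2) ⊘ 2cosh) n   ≡⟨ cong (fromℕ (n !) *_) (⊘-unique (sech·tanh^ 0) 2cosh (const (fromℕ 2)) sech-⊛-2cosh n) ⟩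
  fromℕ (n !) * (A n 0 * exp 1ℤ n)        ≡⟨ rearrange (fromℕ (n !)) (A n 0) (exp 1ℤ n) ⟩
  A n 0 * (exp 1ℤ n * fromℕ (n !))        ≡⟨ cong (A n 0 *_) (exp-*-! 1ℤ n) ⟩
  A n 0 * ((1ℤ ℤ.^ n) / 1)                ≡⟨ cong (λ i → A n 0 * (i / 1)) (ℤ.^-zeroˡ n) ⟩
  A n 0 * 1ℚ                              ≡⟨ ℚ.*-identityʳ (A n 0) ⟩
  A n 0                                   ∎
  where
  rearrange : ∀ x y z → x * (y * z) ≡ y * (z * x)
  rearrange = solve-∀ ring

A-< : ∀ n k → n ℕ.< k → A n k ≡ 0ℚ
A-< zero    (suc k) _         = refl
A-< (suc n) (suc k) (s≤s n<k) = trans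
  (cong₂ (λ p q → fromℕ (suc k) * p + - (fromℕ (suc (suc k)) * q)) (A-< n k n<k) (A-< n (suc (suc k)) (ℕ.m<n⇒m<1+n (ℕ.m<n⇒m<1+n n<k))))
  (vanish (fromℕ (suc k)) (fromℕ (suc (suc k))))
  where
  vanish : ∀ x y → x * 0ℚ + - (y * 0ℚ) ≡ 0ℚ
  vanish = solve-∀ ring

A-diagonal : ∀ n → A n n ≡ fromℕ (n !)
A-diagonal zero    = refl
A-diagonal (suc n) = begin
  fromℕ (suc n) * A n n + - (fromℕ (suc (suc n)) * A n (suc (suc n)))
    ≡⟨ cong₂ (λ p q → fromℕ (suc n) * p + - (fromℕ (suc (suc n)) * q)) (A-diagonal n) (A-< n (suc (suc n)) (ℕ.m<n⇒m<1+n ℕ.≤-refl)) ⟩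
  fromℕ (suc n) * fromℕ (n !) + - (fromℕ (suc (suc n)) * 0ℚ)
    ≡⟨ simplify (fromℕ (suc n)) (fromℕ (n !)) (fromℕ (suc (suc n))) ⟩
  fromℕ (suc n) * fromℕ (n !)
    ≡⟨ fromℕ-* (suc n) (n !) ⟨
  fromℕ (suc n !) ∎
  where
  simplify : ∀ x y z → x * y + - (z * 0ℚ) ≡ x * y
  simplify = solve-∀ ring

-- Triangular factorizations

-- `A n k` is zero when n and k differ in parity, so these two arrays hold everything. Writing
-- `i ℕ.* 2` lets `suc i ℕ.* 2` compute to two successors, so the recurrence unfolds by reduction.
even odd : ℕ → ℕ → ℚ
even i k = A (i ℕ.* 2) (k ℕ.* 2)
odd  i k = A (suc (i ℕ.* 2)) (suc (k ℕ.* 2))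

even-< : ∀ i k → i ℕ.< k → even i k ≡ 0ℚ
even-< i k i<k = A-< (i ℕ.* 2) (k ℕ.* 2) (ℕ.*-monoˡ-< 2 i<k)

odd-< : ∀ i k → i ℕ.< k → odd i k ≡ 0ℚ
odd-< i k i<k = A-< (suc (i ℕ.* 2)) (suc (k ℕ.* 2)) (s≤s (ℕ.*-monoˡ-< 2 i<k))

-- What is left over at `k` when one step of the recurrence moves from one factor to the other; the
-- factor 2k makes it vanish at `k` = 0.
boundary : ℕ → ℕ → ℕ → ℚ
boundary i j k = fromℕ (k ℕ.* 2) * even j k * A (suc (i ℕ.* 2)) (ℕ.pred (k ℕ.* 2))

summation-by-parts : ∀ K i j → boundary i j K ≡ 0ℚ →
  ∑[ k < K ] (even (suc i) (toℕ k) * even j (toℕ k)) ≡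
  - 1ℚ * ∑[ k < K ] (odd i (toℕ k) * odd j (toℕ k))
summation-by-parts K i j boundary≡0 = begin
  ∑[ k < K ] (even (suc i) (toℕ k) * even j (toℕ k))
    ≡⟨ sum-cong-≗ {K} (λ k → term (toℕ k)) ⟩
  ∑[ k < K ] (- 1ℚ * (odd i (toℕ k) * odd j (toℕ k)) + (h (toℕ k) + - h (suc (toℕ k))))
    ≡⟨ sum-linear {K} (- 1ℚ) (λ k → odd i (toℕ k) * odd j (toℕ k)) (λ k → h (toℕ k) + - h (suc (toℕ k))) ⟩
  - 1ℚ * s + ∑[ k < K ] (h (toℕ k) + - h (suc (toℕ k)))
    ≡⟨ cong (- 1ℚ * s +_) (sum-telescope K h) ⟩
  - 1ℚ * s + (h 0 + - h K)
    ≡⟨ cong (λ x → - 1ℚ * s + (h 0 + - x)) boundary≡0 ⟩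
  - 1ℚ * s + (0ℚ * even j 0 * A (suc (i ℕ.* 2)) 0 + - 0ℚ)
    ≡⟨ simplify s (even j 0) (A (suc (i ℕ.* 2)) 0) ⟩
  - 1ℚ * s ∎
  where
  h = boundary i j
  s = ∑[ k < K ] (odd i (toℕ k) * odd j (toℕ k))
  simplify : ∀ s x y → - 1ℚ * s + (0ℚ * x * y + - 0ℚ) ≡ - 1ℚ * s
  simplify = solve-∀ ring
  -- Here x, y, z are 2k, 2k + 1, 2k + 2; p and q are the entries 2k - 1 and 2k + 1 of row 2i + 1; v
  -- and w are the entries 2k and 2k + 2 of row 2j. The recurrence turns `even (suc i) k` into x p -
  -- y q and `odd j k` into y v - z w.
  identity : ∀ x y z p q v w →
    (x * p + - (y * q)) * v ≡ - 1ℚ * (q * (y * v + - (z * w))) + (x * v * p + - (z * w * q))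
  identity = solve-∀ ring
  term : ∀ k → even (suc i) k * even j k ≡ - 1ℚ * (odd i k * odd j k) + (h k + - h (suc k))
  term k = identity (fromℕ (k ℕ.* 2)) (fromℕ (suc (k ℕ.* 2))) (fromℕ (2 ℕ.+ k ℕ.* 2))
    (A (suc (i ℕ.* 2)) (ℕ.pred (k ℕ.* 2))) (odd i k) (even j k) (even j (suc k))

boundary-< : ∀ i j k → j ℕ.< k → boundary i j k ≡ 0ℚ
boundary-< i j k j<k = trans (cong (λ x → fromℕ (k ℕ.* 2) * x * A (suc (i ℕ.* 2)) (ℕ.pred (k ℕ.* 2))) (even-< j k j<k))
  (vanish (fromℕ (k ℕ.* 2)) (A (suc (i ℕ.* 2)) (ℕ.pred (k ℕ.* 2))))
  where
  vanish : ∀ x y → x * 0ℚ * y ≡ 0ℚ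
  vanish = solve-∀ ring

-- Here the entry of row 2i + 1 lies beyond the diagonal, so no bound on `j` is required;
-- `boundary-<` uses the row 2j instead.
boundary-suc-< : ∀ i j k → suc i ℕ.< k → boundary i j k ≡ 0ℚ
boundary-suc-< i j (suc k) (s≤s i<k) = trans (cong (fromℕ (suc k ℕ.* 2) * even j (suc k) *_) (odd-< i k i<k))
  (ℚ.*-zeroʳ (fromℕ (suc k ℕ.* 2) * even j (suc k)))

moment : ℕ → ℚ
moment k = A (k ℕ.* 2) 0

moment-even-odd : ∀ K i j → i ℕ.< K →
  ∑[ k < K ] (even i (toℕ k) * even (suc j) (toℕ k)) ≡ - 1ℚ * ∑[ k < K ] (odd i (toℕ k) * odd j (toℕ k))
moment-even-odd K i j i<K = begin
  ∑[ k < K ] (even i (toℕ k) * even (suc j) (toℕ k))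
    ≡⟨ sum-*-comm {K} (λ k → even i (toℕ k)) (λ k → even (suc j) (toℕ k)) ⟩
  ∑[ k < K ] (even (suc j) (toℕ k) * even i (toℕ k))
    ≡⟨ summation-by-parts K j i (boundary-< j i K i<K) ⟩
  - 1ℚ * ∑[ k < K ] (odd j (toℕ k) * odd i (toℕ k))
    ≡⟨ cong (- 1ℚ *_) (sum-*-comm {K} (λ k → odd j (toℕ k)) (λ k → odd i (toℕ k))) ⟩
  - 1ℚ * ∑[ k < K ] (odd i (toℕ k) * odd j (toℕ k)) ∎

-- Row 0 is the first unit vector, which settles `i` = 0. Induction on `i` then carries a double
-- step from the right factor to the left by way of the odd rows. Only `i` is bounded by `K`, since
-- `j` grows along the way.
moment-even : ∀ K i j → i ℕ.< K → moment (i ℕ.+ j) ≡ ∑[ k < K ] (even i (toℕ k) * even j (toℕ k))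
moment-even (suc K) zero j _ = sym (begin
  1ℚ * moment j + ∑[ k < K ] (0ℚ * even j (suc (toℕ k)))
    ≡⟨ cong₂ _+_ (ℚ.*-identityˡ (moment j)) (sum-zero (λ (k : Fin K) → 0ℚ * even j (suc (toℕ k))) λ k → ℚ.*-zeroˡ (even j (suc (toℕ k)))) ⟩
  moment j + 0ℚ
    ≡⟨ ℚ.+-identityʳ (moment j) ⟩
  moment j ∎)
moment-even K (suc i) j 1+i<K = begin
  moment (suc (i ℕ.+ j))
    ≡⟨ cong moment (ℕ.+-suc i j) ⟨
  moment (i ℕ.+ suc j)
    ≡⟨ moment-even K i (suc j) (ℕ.<⇒≤ 1+i<K) ⟩
  ∑[ k < K ] (even i (toℕ k) * even (suc j) (toℕ k))
    ≡⟨ moment-even-odd K i j (ℕ.<⇒≤ 1+i<K) ⟩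
  - 1ℚ * ∑[ k < K ] (odd i (toℕ k) * odd j (toℕ k))
    ≡⟨ summation-by-parts K i j (boundary-suc-< i j K 1+i<K) ⟨
  ∑[ k < K ] (even (suc i) (toℕ k) * even j (toℕ k)) ∎

moment-odd : ∀ K i j → i ℕ.< K → moment (i ℕ.+ suc j) ≡ - 1ℚ * ∑[ k < K ] (odd i (toℕ k) * odd j (toℕ k))
moment-odd K i j i<K = trans (moment-even K i (suc j) i<K) (moment-even-odd K i j i<K)

-- r k = 4ᵏ k!² / (2k + 1)!, chosen so that the sum in moment-r telescopes.
r : ℕ → ℚ
r zero    = 1ℚ
r (suc k) = r k * ((ℤ.+ (2 ℕ.+ k ℕ.* 2)) / (3 ℕ.+ k ℕ.* 2))

r-suc : ∀ k → r (suc k) * fromℕ (3 ℕ.+ k ℕ.* 2) ≡ r k * fromℕ (2 ℕ.+ k ℕ.* 2)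
r-suc k = trans (ℚ.*-assoc (r k) ((ℤ.+ (2 ℕ.+ k ℕ.* 2)) / (3 ℕ.+ k ℕ.* 2)) (fromℕ (3 ℕ.+ k ℕ.* 2)))
  (cong (r k *_) (/-*-fromℕ (ℤ.+ (2 ℕ.+ k ℕ.* 2)) (3 ℕ.+ k ℕ.* 2)))

moment-r : ∀ K j → j ℕ.< K → moment j ≡ ∑[ k < K ] (r (toℕ k) * odd j (toℕ k))
moment-r K j j<K = sym (begin
  ∑[ k < K ] (r (toℕ k) * odd j (toℕ k))
    ≡⟨ sum-cong-≗ {K} (λ k → term (toℕ k)) ⟩
  ∑[ k < K ] (h (toℕ k) + - h (suc (toℕ k)))
    ≡⟨ sum-telescope K h ⟩
  1ℚ * 1ℚ * moment j + - h K
    ≡⟨ cong (λ x → 1ℚ * 1ℚ * moment j + - (r K * fromℕ (suc (K ℕ.* 2)) * x)) (even-< j K j<K) ⟩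
  1ℚ * 1ℚ * moment j + - (r K * fromℕ (suc (K ℕ.* 2)) * 0ℚ)
    ≡⟨ simplify (moment j) (r K * fromℕ (suc (K ℕ.* 2))) ⟩
  moment j ∎)
  where
  h : ℕ → ℚ
  h k = r k * fromℕ (suc (k ℕ.* 2)) * even j k
  simplify : ∀ x y → 1ℚ * 1ℚ * x + - (y * 0ℚ) ≡ x
  simplify = solve-∀ ring
  distr : ∀ r x y p q → r * (x * p + - (y * q)) ≡ r * x * p + - (r * y * q)
  distr = solve-∀ ring
  -- The recurrence gives coefficients rₖ (2k + 1) and -rₖ (2k + 2); by `r-suc` the latter is -rₖ₊₁
  -- (2k + 3).
  term : ∀ k → r k * odd j k ≡ h k + - h (suc k)
  term k = trans (distr (r k) (fromℕ (suc (k ℕ.* 2))) (fromℕ (2 ℕ.+ k ℕ.* 2)) (even j k) (even j (suc k)))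
    (cong (λ x → h k + - (x * even j (suc k))) (sym (r-suc k)))

-- The two Hankel determinants as products

Hankel-even : ∀ n → H n (λ k → E (2 ℕ.* k)) ≡ ∏ (suc n) (λ k → even k k) * ∏ (suc n) (λ k → even k k)
Hankel-even n = begin
  H n (λ k → E (2 ℕ.* k))
    ≡⟨ det-cong {suc n} (λ i j → E≡moment (toℕ i ℕ.+ toℕ j)) ⟩
  det (suc n) (restrict (suc n) (λ i j → moment (i ℕ.+ j)))
    ≡⟨ det-*-upper-triangular (suc n) (λ i j → moment (i ℕ.+ j)) even (λ k j → even j k)
         (λ i j i<1+n _ → trans (moment-even (suc n) i j i<1+n)
           (sum-*-comm {suc n} (λ k → even i (toℕ k)) (λ k → even j (toℕ k))))
         (λ k j → even-< j k) ⟩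
  ∏ (suc n) (λ k → even k k) * det (suc n) (restrict (suc n) even)
    ≡⟨ cong (∏ (suc n) (λ k → even k k) *_) (det-lower-triangular (suc n) even even-<) ⟩
  ∏ (suc n) (λ k → even k k) * ∏ (suc n) (λ k → even k k) ∎
  where
  E≡moment : ∀ k → E (2 ℕ.* k) ≡ moment k
  E≡moment k = trans (E≡A (2 ℕ.* k)) (cong (λ m → A m 0) (ℕ.*-comm 2 k))

b-suc : ∀ k → b (suc k) ≡ moment k
b-suc k = trans (cong (λ m → E (m ℕ.∸ 2)) (ℕ.*-comm 2 (suc k))) (E≡A (k ℕ.* 2))

bordered : (row column : ℕ → ℚ) → ℚ → (ℕ → ℕ → ℚ) → ℕ → ℕ → ℚ
bordered row column x M zero    zero    = x
bordered row column x M zero    (suc k) = row k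
bordered row column x M (suc i) zero    = column i
bordered row column x M (suc i) (suc k) = M i k

zeros : ℕ → ℚ
zeros _ = 0ℚ

-odd : ℕ → ℕ → ℚ
-odd i k = - 1ℚ * odd i k

-- The right factor is the transpose of `odd` bordered by a unit. The other matrix has already
-- absorbed the left factor: this turns its block -I into `-odd` and its first column r into
-- `moment`, by `moment-r`. The three cases are the first column, the first row and the odd
-- factorization.
b≡product : ∀ n i j → i ℕ.< suc n → j ℕ.< suc n → b (i ℕ.+ j) ≡
  ∑[ k < suc n ] (bordered zeros zeros 1ℚ (λ k j → odd j k) (toℕ k) j * bordered r moment 0ℚ -odd i (toℕ k))
b≡product n i zero _ _ = sym (begin
  1ℚ * N i 0 + ∑[ k < n ] (0ℚ * N i (suc (toℕ k)))
    ≡⟨ cong (1ℚ * N i 0 +_) (sum-zero (λ (k : Fin n) → 0ℚ * N i (suc (toℕ k))) λ k → ℚ.*-zeroˡ (N i (suc (toℕ k)))) ⟩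
  1ℚ * N i 0 + 0ℚ
    ≡⟨ trans (ℚ.+-identityʳ (1ℚ * N i 0)) (ℚ.*-identityˡ (N i 0)) ⟩
  N i 0
    ≡⟨ column i ⟩
  b i
    ≡⟨ cong b (ℕ.+-identityʳ i) ⟨
  b (i ℕ.+ 0) ∎)
  where
  N = bordered r moment 0ℚ -odd
  column : ∀ i → N i 0 ≡ b i
  column zero    = refl
  column (suc i) = sym (b-suc i)
b≡product n zero (suc j) _ (s≤s j<n) = sym (begin
  0ℚ + ∑[ k < n ] (odd j (toℕ k) * r (toℕ k))
    ≡⟨ ℚ.+-identityˡ (∑[ k < n ] (odd j (toℕ k) * r (toℕ k))) ⟩
  ∑[ k < n ] (odd j (toℕ k) * r (toℕ k))
    ≡⟨ sum-*-comm {n} (λ k → odd j (toℕ k)) (λ k → r (toℕ k)) ⟩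
  ∑[ k < n ] (r (toℕ k) * odd j (toℕ k))
    ≡⟨ moment-r n j j<n ⟨
  moment j
    ≡⟨ b-suc j ⟨
  b (suc j) ∎)
b≡product n (suc i) (suc j) (s≤s i<n) _ = begin
  b (suc (i ℕ.+ suc j))
    ≡⟨ b-suc (i ℕ.+ suc j) ⟩
  moment (i ℕ.+ suc j)
    ≡⟨ moment-odd n i j i<n ⟩
  - 1ℚ * ∑[ k < n ] (odd i (toℕ k) * odd j (toℕ k))
    ≡⟨ *-distribˡ-sum {n} (- 1ℚ) (λ k → odd i (toℕ k) * odd j (toℕ k)) ⟩
  ∑[ k < n ] (- 1ℚ * (odd i (toℕ k) * odd j (toℕ k)))
    ≡⟨ sum-cong-≗ {n} (λ k → rearrange (- 1ℚ) (odd i (toℕ k)) (odd j (toℕ k))) ⟩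
  ∑[ k < n ] (odd j (toℕ k) * -odd i (toℕ k))
    ≡⟨ ℚ.+-identityˡ (∑[ k < n ] (odd j (toℕ k) * -odd i (toℕ k))) ⟨
  0ℚ + ∑[ k < n ] (odd j (toℕ k) * -odd i (toℕ k))
    ≡⟨ cong (_+ ∑[ k < n ] (odd j (toℕ k) * -odd i (toℕ k))) (ℚ.*-zeroˡ (moment i)) ⟨
  0ℚ * moment i + ∑[ k < n ] (odd j (toℕ k) * -odd i (toℕ k)) ∎
  where
  rearrange : ∀ x p q → x * (p * q) ≡ q * (x * p)
  rearrange = solve-∀ ring

-- Deleting any column but the first leaves a zero column in the minor, so one Laplace term remains
-- whatever the first row is.
det-unit-column : ∀ n row (M : ℕ → ℕ → ℚ) →
  det (suc n) (restrict (suc n) (bordered row zeros 1ℚ M)) ≡ det n (restrict n M)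
det-unit-column n row M = begin
  1ℚ * 1ℚ * det n (restrict n M) + sum rest
    ≡⟨ cong (1ℚ * 1ℚ * det n (restrict n M) +_) (sum-zero rest rest≡0) ⟩
  1ℚ * 1ℚ * det n (restrict n M) + 0ℚ
    ≡⟨ simplify (det n (restrict n M)) ⟩
  det n (restrict n M) ∎
  where
  simplify : ∀ x → 1ℚ * 1ℚ * x + 0ℚ ≡ x
  simplify = solve-∀ ring
  N = restrict (suc n) (bordered row zeros 1ℚ M)
  rest : Fin n → ℚ
  rest k = sign (suc (toℕ k)) * row (toℕ k) * det n (minor N (suc k))
  column≡0 : ∀ {m} (k : Fin m) → det m (minor (restrict (suc m) (bordered row zeros 1ℚ M)) (suc k)) ≡ 0ℚ
  column≡0 {suc m} k = det-zero-column (minor (restrict (suc (suc m)) (bordered row zeros 1ℚ M)) (suc k)) zero (λ i → refl)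
  rest≡0 : ∀ k → rest k ≡ 0ℚ
  rest≡0 k = trans (cong (sign (suc (toℕ k)) * row (toℕ k) *_) (column≡0 k))
    (ℚ.*-zeroʳ (sign (suc (toℕ k)) * row (toℕ k)))

-- The first column is (∑ r k²) times the first unit vector minus ∑ r k times column k + 1.
det-bordered-r : ∀ n → det (suc n) (restrict (suc n) (bordered r moment 0ℚ -odd)) ≡
  ∑[ k < n ] (r (toℕ k) * r (toℕ k)) * ∏ n (λ k → -odd k k)
det-bordered-r n = begin
  det (suc n) (restrict (suc n) N)
    ≡⟨ det-column-combination (restrict (suc n) N) (restrict (suc n) N′) zero (λ k → a (toℕ k)) (λ i → column (toℕ i) (toℕ<n i)) off ⟩
  R * det (suc n) (restrict (suc n) N′)
    ≡⟨ cong (R *_) (trans (det-unit-column n r -odd) (det-lower-triangular n -odd -odd-<)) ⟩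
  R * ∏ n (λ k → -odd k k) ∎
  where
  R = ∑[ k < n ] (r (toℕ k) * r (toℕ k))
  N  = bordered r moment 0ℚ -odd
  N′ = bordered r zeros 1ℚ -odd
  a : ℕ → ℚ
  a zero    = R
  a (suc k) = - 1ℚ * r k
  -odd-< : ∀ i k → i ℕ.< k → -odd i k ≡ 0ℚ
  -odd-< i k i<k = cong (- 1ℚ *_) (odd-< i k i<k)
  neg-neg : ∀ x y → - 1ℚ * x * (- 1ℚ * y) ≡ x * y
  neg-neg = solve-∀ ring
  cancel : ∀ x → 0ℚ ≡ x * 1ℚ + - 1ℚ * x
  cancel = solve-∀ ring
  column : ∀ i → i ℕ.< suc n → N i 0 ≡ ∑[ k < suc n ] (a (toℕ k) * N′ i (toℕ k))
  column zero _ = begin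
    0ℚ
      ≡⟨ cancel R ⟩
    R * 1ℚ + - 1ℚ * R
      ≡⟨ cong (R * 1ℚ +_) (*-distribˡ-sum {n} (- 1ℚ) (λ k → r (toℕ k) * r (toℕ k))) ⟩
    R * 1ℚ + ∑[ k < n ] (- 1ℚ * (r (toℕ k) * r (toℕ k)))
      ≡⟨ cong (R * 1ℚ +_) (sum-cong-≗ {n} λ k → sym (ℚ.*-assoc (- 1ℚ) (r (toℕ k)) (r (toℕ k)))) ⟩
    R * 1ℚ + ∑[ k < n ] (- 1ℚ * r (toℕ k) * r (toℕ k)) ∎
  column (suc i) (s≤s i<n) = begin
    moment i
      ≡⟨ moment-r n i i<n ⟩
    ∑[ k < n ] (r (toℕ k) * odd i (toℕ k))
      ≡⟨ sum-cong-≗ {n} (λ k → sym (neg-neg (r (toℕ k)) (odd i (toℕ k)))) ⟩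
    ∑[ k < n ] (- 1ℚ * r (toℕ k) * -odd i (toℕ k))
      ≡⟨ ℚ.+-identityˡ (∑[ k < n ] (- 1ℚ * r (toℕ k) * -odd i (toℕ k))) ⟨
    0ℚ + ∑[ k < n ] (- 1ℚ * r (toℕ k) * -odd i (toℕ k))
      ≡⟨ cong (_+ ∑[ k < n ] (- 1ℚ * r (toℕ k) * -odd i (toℕ k))) (ℚ.*-zeroʳ R) ⟨
    R * 0ℚ + ∑[ k < n ] (- 1ℚ * r (toℕ k) * -odd i (toℕ k)) ∎
  off : restrict (suc n) N ≈ restrict (suc n) N′ off zero
  off i       zero    0≢0 = contradiction refl 0≢0
  off zero    (suc k) _   = refl
  off (suc i) (suc k) _   = refl

Hankel-b : ∀ n → H n b ≡
  ∏ n (λ k → odd k k) * (∑[ k < n ] (r (toℕ k) * r (toℕ k)) * ∏ n (λ k → -odd k k))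
Hankel-b n = begin
  det (suc n) (restrict (suc n) (λ i j → b (i ℕ.+ j)))
    ≡⟨ det-*-upper-triangular (suc n) (λ i j → b (i ℕ.+ j)) (bordered r moment 0ℚ -odd) U (b≡product n) U-upper ⟩
  ∏ (suc n) (λ k → U k k) * det (suc n) (restrict (suc n) (bordered r moment 0ℚ -odd))
    ≡⟨ cong₂ _*_ (trans (∏-head n (λ k → U k k)) (ℚ.*-identityˡ (∏ n (λ k → odd k k)))) (det-bordered-r n) ⟩
  ∏ n (λ k → odd k k) * (∑[ k < n ] (r (toℕ k) * r (toℕ k)) * ∏ n (λ k → -odd k k)) ∎
  where
  U = bordered zeros zeros 1ℚ (λ k j → odd j k)
  U-upper : ∀ k j → j ℕ.< k → U k j ≡ 0ℚ
  U-upper (suc k) zero    _         = refl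
  U-upper (suc k) (suc j) (s≤s j<k) = odd-< j k j<k

-- Closed forms of the constants

r-! : ∀ j → r j * fromℕ (suc (j ℕ.* 2) !) ≡ fromℕ (4 ℕ.^ j) * (fromℕ (j !) * fromℕ (j !))
r-! zero    = refl
r-! (suc j) = begin
  r (suc j) * fromℕ ((3 ℕ.+ j ℕ.* 2) !)
    ≡⟨ cong (r (suc j) *_) (trans (fromℕ-* (3 ℕ.+ j ℕ.* 2) ((2 ℕ.+ j ℕ.* 2) !))
         (cong (fromℕ (3 ℕ.+ j ℕ.* 2) *_) (fromℕ-* (2 ℕ.+ j ℕ.* 2) (suc (j ℕ.* 2) !)))) ⟩
  r (suc j) * (fromℕ (3 ℕ.+ j ℕ.* 2) * (x * fromℕ (suc (j ℕ.* 2) !)))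
    ≡⟨ ℚ.*-assoc (r (suc j)) (fromℕ (3 ℕ.+ j ℕ.* 2)) (x * fromℕ (suc (j ℕ.* 2) !)) ⟨
  r (suc j) * fromℕ (3 ℕ.+ j ℕ.* 2) * (x * fromℕ (suc (j ℕ.* 2) !))
    ≡⟨ cong (_* (x * fromℕ (suc (j ℕ.* 2) !))) (r-suc j) ⟩
  -- The new factor 2j + 3 of the factorial cancels the denominator of `r (suc j)`; its numerator
  -- and the factor 2j + 2 give (2j + 2)² = 4 (j + 1)².
  r j * x * (x * fromℕ (suc (j ℕ.* 2) !))
    ≡⟨ rearrange (r j) x (fromℕ (suc (j ℕ.* 2) !)) ⟩
  x * x * (r j * fromℕ (suc (j ℕ.* 2) !))
    ≡⟨ cong₂ (λ y z → y * y * z) (fromℕ-* (suc j) 2) (r-! j) ⟩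
  (s * fromℕ 2) * (s * fromℕ 2) * (fromℕ (4 ℕ.^ j) * (fromℕ (j !) * fromℕ (j !)))
    ≡⟨ regroup s (fromℕ (4 ℕ.^ j)) (fromℕ (j !)) ⟩
  (fromℕ 4 * fromℕ (4 ℕ.^ j)) * ((s * fromℕ (j !)) * (s * fromℕ (j !)))
    ≡⟨ cong₂ (λ y z → y * (z * z)) (fromℕ-* 4 (4 ℕ.^ j)) (fromℕ-* (suc j) (j !)) ⟨
  fromℕ (4 ℕ.^ suc j) * (fromℕ (suc j !) * fromℕ (suc j !)) ∎
  where
  x = fromℕ (2 ℕ.+ j ℕ.* 2)
  s = fromℕ (suc j)
  rearrange : ∀ r x y → r * x * (x * y) ≡ x * x * (r * y)
  rearrange = solve-∀ ring
  regroup : ∀ s p q → (s * fromℕ 2) * (s * fromℕ 2) * (p * (q * q)) ≡ (fromℕ 4 * p) * ((s * q) * (s * q))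
  regroup = solve-∀ ring

central-binomial-! : ∀ j → ((2 ℕ.* j) C j) ℕ.* (j ! ℕ.* j !) ≡ (2 ℕ.* j) !
central-binomial-! j = begin
  ((2 ℕ.* j) C j) ℕ.* (j ! ℕ.* j !)
    ≡⟨ cong (λ m → ((2 ℕ.* j) C j) ℕ.* (j ! ℕ.* m !)) 2j∸j≡j ⟨
  ((2 ℕ.* j) C j) ℕ.* (j ! ℕ.* (2 ℕ.* j ℕ.∸ j) !)
    ≡⟨ cong (ℕ._* (j ! ℕ.* (2 ℕ.* j ℕ.∸ j) !)) (nCk≡n!/k![n-k]! j≤2j) ⟩
  ((2 ℕ.* j) ! ℕ./ (j ! ℕ.* (2 ℕ.* j ℕ.∸ j) !)) ℕ.* (j ! ℕ.* (2 ℕ.* j ℕ.∸ j) !)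
    ≡⟨ m/n*n≡m (k![n∸k]!∣n! j≤2j) ⟩
  (2 ℕ.* j) ! ∎
  where
  instance
    _ = j ℕ.!* (2 ℕ.* j ℕ.∸ j) !≢0
  j≤2j : j ℕ.≤ 2 ℕ.* j
  j≤2j = ℕ.m≤m+n j (j ℕ.+ 0)
  2j∸j≡j : 2 ℕ.* j ℕ.∸ j ≡ j
  2j∸j≡j = trans (ℕ.m+n∸m≡n j (j ℕ.+ 0)) (ℕ.+-identityʳ j)

-- Since (2j + 1)! is 2j + 1 times the central binomial coefficient times j!², this is `r-!` with
-- j!² cancelled. Its square identifies the terms of `𝒦`.
r-binomial : ∀ j → r j * (fromℕ (2 ℕ.* j ℕ.+ 1) * fromℕ ((2 ℕ.* j) C j)) ≡ fromℕ (4 ℕ.^ j)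
r-binomial j = fromℕ-*-cancelˡ (j ! ℕ.* j !) {{ℕ.m*n≢0 (j !) (j !) {{j ℕ.!≢0}} {{j ℕ.!≢0}}}} (begin
  fromℕ (j ! ℕ.* j !) * (r j * (x * fromℕ ((2 ℕ.* j) C j)))
    ≡⟨ rearrange (fromℕ (j ! ℕ.* j !)) (r j) x (fromℕ ((2 ℕ.* j) C j)) ⟩
  r j * (x * (fromℕ ((2 ℕ.* j) C j) * fromℕ (j ! ℕ.* j !)))
    ≡⟨ cong (λ y → r j * (x * y)) (fromℕ-* ((2 ℕ.* j) C j) (j ! ℕ.* j !)) ⟨
  r j * (x * fromℕ (((2 ℕ.* j) C j) ℕ.* (j ! ℕ.* j !)))
    ≡⟨ cong (λ m → r j * (x * fromℕ m)) (central-binomial-! j) ⟩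
  r j * (x * fromℕ ((2 ℕ.* j) !))
    ≡⟨ cong (r j *_) (fromℕ-* (2 ℕ.* j ℕ.+ 1) ((2 ℕ.* j) !)) ⟨
  r j * fromℕ ((2 ℕ.* j ℕ.+ 1) ℕ.* (2 ℕ.* j) !)
    ≡⟨ cong₂ (λ m k → r j * fromℕ (m ℕ.* k !)) (trans (ℕ.+-comm (2 ℕ.* j) 1) (cong suc (ℕ.*-comm 2 j))) (ℕ.*-comm 2 j) ⟩
  r j * fromℕ (suc (j ℕ.* 2) !)
    ≡⟨ r-! j ⟩
  fromℕ (4 ℕ.^ j) * (fromℕ (j !) * fromℕ (j !))
    ≡⟨ trans (cong (fromℕ (4 ℕ.^ j) *_) (sym (fromℕ-* (j !) (j !)))) (ℚ.*-comm (fromℕ (4 ℕ.^ j)) (fromℕ (j ! ℕ.* j !))) ⟩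
  fromℕ (j ! ℕ.* j !) * fromℕ (4 ℕ.^ j) ∎)
  where
  x = fromℕ (2 ℕ.* j ℕ.+ 1)
  rearrange : ∀ d r x y → d * (r * (x * y)) ≡ r * (x * (y * d))
  rearrange = solve-∀ ring

fromℕ-^2 : ∀ n → fromℕ (n ℕ.^ 2) ≡ fromℕ n * fromℕ n
fromℕ-^2 n = trans (cong (λ m → fromℕ (n ℕ.* m)) (ℕ.*-identityʳ n)) (fromℕ-* n n)

r² : ∀ j → ((ℤ.+ (16 ℕ.^ j)) / ((2 ℕ.* j ℕ.+ 1) ℕ.^ 2 ℕ.* ((2 ℕ.* j) C j) ℕ.^ 2)) {{𝒦-denom≢0 j}} ≡ r j * r j
r² j = fromℕ-*-cancelˡ d {{𝒦-denom≢0 j}} (begin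
  fromℕ d * ((ℤ.+ (16 ℕ.^ j)) / d) {{𝒦-denom≢0 j}}
    ≡⟨ trans (ℚ.*-comm (fromℕ d) _) (/-*-fromℕ (ℤ.+ (16 ℕ.^ j)) d {{𝒦-denom≢0 j}}) ⟩
  fromℕ (16 ℕ.^ j)
    ≡⟨ cong fromℕ (trans (ℕ.^-*-assoc 4 2 j) (trans (cong (4 ℕ.^_) (ℕ.*-comm 2 j)) (sym (ℕ.^-*-assoc 4 j 2)))) ⟩
  fromℕ ((4 ℕ.^ j) ℕ.^ 2)
    ≡⟨ fromℕ-^2 (4 ℕ.^ j) ⟩
  fromℕ (4 ℕ.^ j) * fromℕ (4 ℕ.^ j)
    ≡⟨ cong₂ _*_ (r-binomial j) (r-binomial j) ⟨
  r j * (x * y) * (r j * (x * y))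
    ≡⟨ rearrange (r j) x y ⟩
  x * x * (y * y) * (r j * r j)
    ≡⟨ cong (_* (r j * r j)) (trans (fromℕ-* ((2 ℕ.* j ℕ.+ 1) ℕ.^ 2) (((2 ℕ.* j) C j) ℕ.^ 2))
         (cong₂ _*_ (fromℕ-^2 (2 ℕ.* j ℕ.+ 1)) (fromℕ-^2 ((2 ℕ.* j) C j)))) ⟨
  fromℕ d * (r j * r j) ∎)
  where
  d = (2 ℕ.* j ℕ.+ 1) ℕ.^ 2 ℕ.* ((2 ℕ.* j) C j) ℕ.^ 2
  x = fromℕ (2 ℕ.* j ℕ.+ 1)
  y = fromℕ ((2 ℕ.* j) C j)
  rearrange : ∀ r x y → r * (x * y) * (r * (x * y)) ≡ x * x * (y * y) * (r * r)
  rearrange = solve-∀ ring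

even-suc : ∀ k → even (suc k) (suc k) ≡ fromℕ 2 * (fromℕ (suc k) * odd k k)
even-suc k = begin
  even (suc k) (suc k)
    ≡⟨ A-diagonal (suc k ℕ.* 2) ⟩
  fromℕ ((suc k ℕ.* 2) !)
    ≡⟨ fromℕ-* (suc k ℕ.* 2) (suc (k ℕ.* 2) !) ⟩
  fromℕ (suc k ℕ.* 2) * fromℕ (suc (k ℕ.* 2) !)
    ≡⟨ cong₂ _*_ (fromℕ-* (suc k) 2) (sym (A-diagonal (suc (k ℕ.* 2)))) ⟩
  fromℕ (suc k) * fromℕ 2 * odd k k
    ≡⟨ rearrange (fromℕ (suc k)) (fromℕ 2) (odd k k) ⟩
  fromℕ 2 * (fromℕ (suc k) * odd k k) ∎
  where
  rearrange : ∀ x y z → x * y * z ≡ y * (x * z)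
  rearrange = solve-∀ ring

-- Passing to n + 1 multiplies the left side by -4 (n + 1)² (2n + 1)!² and the right side by -(2n +
-- 2)!², which agree by `even-suc`. The even products have one factor more, starting with 0! = 1.
∏-ratio : ∀ n → fromℕ (4 ℕ.^ n ℕ.* (n !) ℕ.^ 2) * (∏ n (λ k → odd k k) * ∏ n (λ k → -odd k k)) ≡
  sign n * (∏ (suc n) (λ k → even k k) * ∏ (suc n) (λ k → even k k))
∏-ratio zero    = refl
∏-ratio (suc n) = begin
  fromℕ (4 ℕ.^ suc n ℕ.* (suc n !) ℕ.^ 2) * (p * o * (q * -odd n n))
    ≡⟨ cong (_* (p * o * (q * -odd n n))) denominator ⟩
  fromℕ 4 * (s * s) * d * (p * o * (q * (- 1ℚ * o)))
    ≡⟨ regroup s d p q o ⟩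
  - 1ℚ * (d * (p * q)) * ((fromℕ 2 * (s * o)) * (fromℕ 2 * (s * o)))
    ≡⟨ cong₂ (λ x y → - 1ℚ * x * (y * y)) (∏-ratio n) (sym (even-suc n)) ⟩
  - 1ℚ * (sign n * (e * e)) * (even (suc n) (suc n) * even (suc n) (suc n))
    ≡⟨ regroup′ (- 1ℚ) (sign n) e (even (suc n) (suc n)) ⟩
  - 1ℚ * sign n * (e * even (suc n) (suc n) * (e * even (suc n) (suc n)))
    ≡⟨ cong (_* (e * even (suc n) (suc n) * (e * even (suc n) (suc n)))) (sign-suc n) ⟨
  sign (suc n) * (e * even (suc n) (suc n) * (e * even (suc n) (suc n))) ∎
  where
  d = fromℕ (4 ℕ.^ n ℕ.* (n !) ℕ.^ 2)
  s = fromℕ (suc n)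
  p = ∏ n (λ k → odd k k)
  q = ∏ n (λ k → -odd k k)
  e = ∏ (suc n) (λ k → even k k)
  o = odd n n
  regroup : ∀ s d p q o → fromℕ 4 * (s * s) * d * (p * o * (q * (- 1ℚ * o))) ≡
    - 1ℚ * (d * (p * q)) * ((fromℕ 2 * (s * o)) * (fromℕ 2 * (s * o)))
  regroup = solve-∀ ring
  regroup′ : ∀ m x e f → m * (x * (e * e)) * (f * f) ≡ m * x * (e * f * (e * f))
  regroup′ = solve-∀ ring
  split : ∀ n → fromℕ (4 ℕ.^ n ℕ.* (n !) ℕ.^ 2) ≡ fromℕ (4 ℕ.^ n) * (fromℕ (n !) * fromℕ (n !))
  split n = trans (fromℕ-* (4 ℕ.^ n) ((n !) ℕ.^ 2)) (cong (fromℕ (4 ℕ.^ n) *_) (fromℕ-^2 (n !)))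
  regroup″ : ∀ x y s f → x * y * (s * f * (s * f)) ≡ x * (s * s) * (y * (f * f))
  regroup″ = solve-∀ ring
  denominator : fromℕ (4 ℕ.^ suc n ℕ.* (suc n !) ℕ.^ 2) ≡ fromℕ 4 * (s * s) * d
  denominator = begin
    fromℕ (4 ℕ.^ suc n ℕ.* (suc n !) ℕ.^ 2)
      ≡⟨ split (suc n) ⟩
    fromℕ (4 ℕ.^ suc n) * (fromℕ (suc n !) * fromℕ (suc n !))
      ≡⟨ cong₂ (λ x y → x * (y * y)) (fromℕ-* 4 (4 ℕ.^ n)) (fromℕ-* (suc n) (n !)) ⟩
    fromℕ 4 * fromℕ (4 ℕ.^ n) * (s * fromℕ (n !) * (s * fromℕ (n !)))
      ≡⟨ regroup″ (fromℕ 4) (fromℕ (4 ℕ.^ n)) s (fromℕ (n !)) ⟩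
    fromℕ 4 * (s * s) * (fromℕ (4 ℕ.^ n) * (fromℕ (n !) * fromℕ (n !)))
      ≡⟨ cong (fromℕ 4 * (s * s) *_) (split n) ⟨
    fromℕ 4 * (s * s) * d ∎

proposition7p3 : ∀ (n : ℕ) → 1 ℕ.≤ n →
    H n b ≡ ((-1ℤ ℤ.^ n) / (4 ℕ.^ n ℕ.* (n !) ℕ.^ 2)) {{4ⁿn!²≢0 n}} * 𝒦 n * H n (λ k → E (2 ℕ.* k))
proposition7p3 n _ = fromℕ-*-cancelˡ d {{4ⁿn!²≢0 n}} (begin
  fromℕ d * H n b
    ≡⟨ cong (fromℕ d *_) (Hankel-b n) ⟩
  fromℕ d * (p * (R * q))
    ≡⟨ rearrange (fromℕ d) p R q ⟩
  fromℕ d * (p * q) * R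
    ≡⟨ cong (_* R) (∏-ratio n) ⟩
  sign n * (e * e) * R
    ≡⟨ cong₂ (λ x y → x * (e * e) * y) (/-*-fromℕ (-1ℤ ℤ.^ n) d {{4ⁿn!²≢0 n}}) (sum-cong-≗ {n} λ k → r² (toℕ k)) ⟨
  c * fromℕ d * (e * e) * 𝒦 n
    ≡⟨ rearrange′ c (fromℕ d) (e * e) (𝒦 n) ⟩
  fromℕ d * (c * 𝒦 n * (e * e))
    ≡⟨ cong (λ h → fromℕ d * (c * 𝒦 n * h)) (Hankel-even n) ⟨
  fromℕ d * (c * 𝒦 n * H n (λ k → E (2 ℕ.* k))) ∎)
  where
  d = 4 ℕ.^ n ℕ.* (n !) ℕ.^ 2
  c = ((-1ℤ ℤ.^ n) / d) {{4ⁿn!²≢0 n}}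
  R = ∑[ k < n ] (r (toℕ k) * r (toℕ k))
  p = ∏ n (λ k → odd k k)
  q = ∏ n (λ k → -odd k k)
  e = ∏ (suc n) (λ k → even k k)
  rearrange : ∀ d p R q → d * (p * (R * q)) ≡ d * (p * q) * R
  rearrange = solve-∀ ring
  rearrange′ : ∀ c d h k → c * d * h * k ≡ d * (c * k * h)
  rearrange′ = solve-∀ ring
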